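{- Let $G$ be a finite, $k$-regular partial cube with girth $g(G)=6$. Then the following are equivalent: (a) all convex cycles of $G$ are $6$-cycles; (b) every path of length $3$ in $G$ is contained in a $6$-cycle; (c) $G\cong\tilde{O}_k$.
   Context: A partial cube is a graph isomorphic to an isometric subgraph of some hypercube. The girth $g(G)$ is the length of a shortest cycle. A subgraph $H$ of $G$ is convex if for all $u,v\in V(H)$ every shortest $u,v$-path of $G$ lies in $H$; a convex cycle is a cycle that is convex. For $k\geqslant 1$, the Doubled Odd graph $\tilde{O}_k$ is the bipartite graph whose vertices are the $(k-1)$-subsets and the $k$-subsets of $\{1,\dots,2k-1\}$, where a $(k-1)$-subset $u$ and a $k$-subset $v$ are adjacent iff $u\subset v$. -}

module Defs where

open import Data.Nat using (ℕ; zero; suc; _+_; _*_; _∸_; _≤_; _<_)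
open import Data.Bool using (Bool; true; false)
open import Data.Fin using (Fin; toℕ; fromℕ; inject₁) renaming (zero to fzero; suc to fsuc)
open import Data.Fin.Subset using (Subset; _⊆_; ∣_∣)
open import Data.Vec using (Vec; tabulate)
open import Data.Product using (Σ; ∃; ∃-syntax; _×_; _,_)
open import Data.Sum using (_⊎_)
open import Relation.Nullary using (¬_)
open import Relation.Binary.PropositionalEquality using (_≡_; _≢_)
open import Function.Definitions using (Injective)

record Graph : Set where
  field
    n     : ℕ
    adj   : Fin n → Fin n → Bool
    adj-sym  : ∀ x y → adj x y ≡ adj y x
    adj-irr  : ∀ x → adj x x ≡ false

module _ (G : Graph) where
  open Graph G

  Adj : Fin n → Fin n → Set
  Adj x y = adj x y ≡ true

  degree : Fin n → ℕ
  degree v = ∣ tabulate (adj v) ∣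

  Regular : ℕ → Set
  Regular k = ∀ v → degree v ≡ k

  record Walk (m : ℕ) (u v : Fin n) : Set where
    field
      p     : Fin (suc m) → Fin n
      start : p fzero ≡ u
      end   : p (fromℕ m) ≡ v
      step  : ∀ (i : Fin m) → Adj (p (inject₁ i)) (p (fsuc i))

  IsPath : ∀ {m u v} → Walk m u v → Set
  IsPath w = Injective _≡_ _≡_ (Walk.p w)

  Dist : Fin n → Fin n → ℕ → Set
  Dist u v m = Walk m u v × (∀ m' → Walk m' u v → m ≤ m')

  IsShortest : ∀ {m u v} → Walk m u v → Set
  IsShortest {m} {u} {v} _ = Dist u v m

  hamming : ∀ {d} → Vec Bool d → Vec Bool d → ℕ
  hamming Vec.[] Vec.[] = 0
  hamming (true Vec.∷ xs) (true Vec.∷ ys) = hamming xs ys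
  hamming (false Vec.∷ xs) (false Vec.∷ ys) = hamming xs ys
  hamming (true Vec.∷ xs) (false Vec.∷ ys) = suc (hamming xs ys)
  hamming (false Vec.∷ xs) (true Vec.∷ ys) = suc (hamming xs ys)

  -- G is a partial cube: G is isomorphic to an isometric subgraph of
  -- some hypercube Q_d, i.e. there is a map f : V(G) → V(Q_d) with
  -- d_G(u,v) = d_{Q_d}(f u, f v) (Hamming distance) for all u, v.
  -- (Such f is automatically injective and G connected.)
  PartialCube : Set
  PartialCube = ∃[ d ] Σ (Fin n → Vec Bool d) λ f →
                  ∀ u v → Dist u v (hamming (f u) (f v))

  Consecutive : ∀ {ℓ} → Fin ℓ → Fin ℓ → Set
  Consecutive {ℓ} i j = (suc (toℕ i) ≡ toℕ j) ⊎ (suc (toℕ i) ≡ ℓ × toℕ j ≡ 0)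

  record Cycle (ℓ : ℕ) : Set where
    field
      len≥3 : 3 ≤ ℓ
      c     : Fin ℓ → Fin n
      inj   : Injective _≡_ _≡_ c
      edges : ∀ (i j : Fin ℓ) → Consecutive i j → Adj (c i) (c j)

  OnCycle : ∀ {ℓ} → Cycle ℓ → Fin n → Set
  OnCycle C x = ∃[ i ] Cycle.c C i ≡ x

  CycleEdge : ∀ {ℓ} → Cycle ℓ → Fin n → Fin n → Set
  CycleEdge C x y = ∃[ i ] ∃[ j ] Consecutive i j ×
      ((Cycle.c C i ≡ x × Cycle.c C j ≡ y) ⊎ (Cycle.c C i ≡ y × Cycle.c C j ≡ x))

  WalkInCycle : ∀ {ℓ m u v} → Cycle ℓ → Walk m u v → Set
  WalkInCycle {m = m} C w =
    (∀ (i : Fin (suc m)) → OnCycle C (Walk.p w i)) ×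
    (∀ (i : Fin m) → CycleEdge C (Walk.p w (inject₁ i)) (Walk.p w (fsuc i)))

  ConvexCycle : ∀ {ℓ} → Cycle ℓ → Set
  ConvexCycle C = ∀ u v → OnCycle C u → OnCycle C v →
    ∀ m (w : Walk m u v) → IsShortest w → WalkInCycle C w

  Girth : ℕ → Set
  Girth g = Cycle g × (∀ ℓ → ℓ < g → ¬ Cycle ℓ)

  AllConvexCycles6 : Set
  AllConvexCycles6 = ∀ ℓ (C : Cycle ℓ) → ConvexCycle C → ℓ ≡ 6

  P3InC6 : Set
  P3InC6 = ∀ u v (w : Walk 3 u v) → IsPath w → Σ (Cycle 6) λ C → WalkInCycle C w

DOVertex : (k : ℕ) → Subset (2 * k ∸ 1) → Set
DOVertex k s = (∣ s ∣ ≡ k ∸ 1) ⊎ (∣ s ∣ ≡ k)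

DOAdj : (k : ℕ) → Subset (2 * k ∸ 1) → Subset (2 * k ∸ 1) → Set
DOAdj k s t = (∣ s ∣ ≡ k ∸ 1 × ∣ t ∣ ≡ k × s ⊆ t)
            ⊎ (∣ t ∣ ≡ k ∸ 1 × ∣ s ∣ ≡ k × t ⊆ s)

IsoDoubledOdd : Graph → ℕ → Set
IsoDoubledOdd G k =
  Σ (Fin (Graph.n G) → Subset (2 * k ∸ 1)) λ φ →
    Injective _≡_ _≡_ φ ×
    (∀ x → DOVertex k (φ x)) ×
    (∀ s → DOVertex k s → ∃[ x ] φ x ≡ s) ×
    (∀ x y → (Adj G x y → DOAdj k (φ x) (φ y)) × (DOAdj k (φ x) (φ y) → Adj G x y))

{-# OPTIONS --safe #-}
-- Work in the image S of G in the cube.  If all convex cycles are hexagons, two edges of a class d without another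
-- edge of d between them lie in a common hexagon, since their interval is a convex cycle.  Let U be the set of
-- endpoints of edges of a class a.  A Sylvester–Gallai type descent on the distance from v to y shows: a path
-- v, v+b, v+b+d from v ∈ U ends in U as soon as d separates v from some y ∈ U.  For a minimal halfspace every class
-- occurring in it separates two vertices of U; regularity then carries this to the opposite halfspace, so any path of
-- length three with an edge of class a lies in a hexagon, and every class turns out to bound a minimal halfspace.
-- Conversely, if all such paths lie in hexagons, the directions at x and at its neighbours together form a set Λ
-- of 2k-1 coordinates independent of x, and translating S by o + N(o), with N(o) the set of directions at a base
-- vertex o, maps it onto the two middle layers of the cube on Λ.
module Submission where

open import Defs
open import Data.Bool using (Bool; true; false; not; _xor_; _∨_)
open import Data.Bool.Properties using (¬-not; not-¬; not-involutive; ∨-zeroʳ) renaming (_≟_ to _≟ᵇ_)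
open import Data.Empty using (⊥; ⊥-elim)
open import Data.Fin using (Fin; zero; suc; _≟_; toℕ; fromℕ<; inject₁)
open import Data.Fin.Patterns using (0F; 1F; 2F; 3F; 4F; 5F)
open import Data.Fin.Properties as Fin using (any?; all?; toℕ-injective; toℕ<n; toℕ-fromℕ<)
open import Data.Fin.Subset using (Subset; ∣_∣; _∪_; _⊆_)
open import Data.Nat using (ℕ; zero; suc; _+_; _*_; _∸_; _≤_; _<_; z≤n; s≤s)
open import Data.Nat.Properties as ℕ using (suc-injective; ≤-trans; ≤-refl; ≤-reflexive; +-suc)
open import Data.Product using (Σ; ∃-syntax; _×_; _,_; proj₁; proj₂)
open import Data.Sum using (_⊎_; inj₁; inj₂; [_,_]′)
open import Data.Vec using (Vec; []; _∷_; lookup; updateAt; zipWith; tabulate)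
open import Data.Vec.Properties
  using (lookup∘updateAt; lookup∘updateAt′; lookup-zipWith; lookup∘tabulate; tabulate∘lookup; tabulate-cong;
         ≡-dec; lookup⇒[]=; []=⇒lookup)
open import Data.Vec.Relation.Unary.All using ([]; _∷_)
open import Data.Vec.Relation.Unary.AllPairs using ([]; _∷_)
open import Data.Vec.Relation.Unary.Unique.Propositional using (Unique)
open import Data.Vec.Relation.Unary.Unique.Propositional.Properties using (lookup-injective)
open import Function using (_∘_; id)
open import Function.Bundles using (_⇔_; mk⇔)
open import Function.Definitions using (Injective)
open import Relation.Nullary using (¬_; Dec; yes; no; does; contradiction)
open import Relation.Nullary.Decidable using (_×-dec_; _→-dec_; ¬?; dec-true)
open import Relation.Binary.PropositionalEquality
  using (_≡_; _≢_; refl; sym; trans; cong; cong₂; subst; subst₂; ≢-sym)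

-- The obstacle in the descent is a last hexagon before `y` that itself crosses `d`: its next vertex
-- of U is nearer to `v` but no longer separated from it by `d`. The edges of that hexagon then
-- become targets, and classes are followed to them from v+b. Changing course is possible because,
-- without squares, v+b+d lies in U exactly when v+a+d is a vertex, so `b` may be exchanged for
-- another direction at `v`. Regularity is used as a count: an inclusion between two neighbourhoods,
-- each without one edge already accounted for, is an equality. In the converse, 2k-1 is the k
-- directions at `o` plus the k-1 further ones at a neighbour; a common one would close a square.
-- The translation is dictated by what an edge `i` does: N(x+i) consists of `i` and of the elements
-- of Λ outside N(x), so N(x+i) has complement N(x) without `i` in Λ. Up to complements the
-- neighbourhood thus changes in the coordinate `i` only, just as the vertex does, and its sum with
-- the vertex stays o + N(o).

infixl 7 _‼_
infixl 8 _⊹_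
infixl 8 _⊕_

_‼_ : ∀ {A : Set} {D} → Vec A D → Fin D → A
_‼_ = lookup

_⊹_ : ∀ {D} → Vec Bool D → Fin D → Vec Bool D
x ⊹ i = updateAt x i not

_⊕_ : ∀ {D} → Vec Bool D → Vec Bool D → Vec Bool D
x ⊕ y = zipWith _xor_ x y

-- Written as a cardinality, so that inclusions of subsets compare distances and an inclusion
-- between sets of equal size identifies vertices.
ham : ∀ {D} → Vec Bool D → Vec Bool D → ℕ
ham x y = ∣ x ⊕ y ∣

≢-≢⇒≡ : ∀ {a b c : Bool} → a ≢ b → b ≢ c → a ≡ c
≢-≢⇒≡ p q = trans (¬-not p) (sym (¬-not (≢-sym q)))

≢-≡⇒≢ : ∀ {A : Set} {a b c : A} → a ≢ b → b ≡ c → a ≢ c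
≢-≡⇒≢ p refl = p

≡-≢⇒≢ : ∀ {A : Set} {a b c : A} → a ≡ b → b ≢ c → a ≢ c
≡-≢⇒≢ refl p = p

not-≢ : ∀ {a} → not a ≢ a
not-≢ e = not-¬ refl (sym e)

decide≢ : ∀ {a b : Bool} → ¬ (a ≢ b) → a ≡ b
decide≢ {a} {b} h with a ≟ᵇ b
... | yes e = e
... | no ne = ⊥-elim (h ne)

-- Flipping coordinates

⊹-at : ∀ {D} (x : Vec Bool D) i → (x ⊹ i) ‼ i ≡ not (x ‼ i)
⊹-at x i = lookup∘updateAt i x

⊹-off : ∀ {D} (x : Vec Bool D) {i j} → j ≢ i → (x ⊹ i) ‼ j ≡ x ‼ j
⊹-off x {i} {j} ne = lookup∘updateAt′ j i ne x

‼-ext : ∀ {A : Set} {D} {x y : Vec A D} → (∀ j → x ‼ j ≡ y ‼ j) → x ≡ y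
‼-ext {x = x} {y} h = trans (sym (tabulate∘lookup x)) (trans (tabulate-cong h) (tabulate∘lookup y))

⊹-inv : ∀ {D} (x : Vec Bool D) i → x ⊹ i ⊹ i ≡ x
⊹-inv (b ∷ x) zero    = cong (_∷ x) (not-involutive b)
⊹-inv (b ∷ x) (suc i) = cong (b ∷_) (⊹-inv x i)

⊹-comm : ∀ {D} (x : Vec Bool D) i j → x ⊹ i ⊹ j ≡ x ⊹ j ⊹ i
⊹-comm (b ∷ x) zero    zero    = refl
⊹-comm (b ∷ x) zero    (suc j) = refl
⊹-comm (b ∷ x) (suc i) zero    = refl
⊹-comm (b ∷ x) (suc i) (suc j) = cong (b ∷_) (⊹-comm x i j)

⊹-≢ : ∀ {D} (x : Vec Bool D) i → x ⊹ i ≢ x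
⊹-≢ x i e = not-≢ (trans (sym (⊹-at x i)) (cong (_‼ i) e))

⊹-dir : ∀ {D} (x : Vec Bool D) i j → x ⊹ i ≡ x ⊹ j → i ≡ j
⊹-dir x i j e with i ≟ j
... | yes p = p
... | no ne = ⊥-elim (not-≢ (trans (sym (⊹-at x i)) (trans (cong (_‼ i) e) (⊹-off x ne))))

⊕-⊹ : ∀ {D} (x y : Vec Bool D) i → (x ⊹ i) ⊕ y ≡ (x ⊕ y) ⊹ i
⊕-⊹ (a ∷ x) (b ∷ y) (suc i) = cong (_ ∷_) (⊕-⊹ x y i)
⊕-⊹ (true  ∷ x) (true  ∷ y) zero = refl
⊕-⊹ (true  ∷ x) (false ∷ y) zero = refl
⊕-⊹ (false ∷ x) (true  ∷ y) zero = refl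
⊕-⊹ (false ∷ x) (false ∷ y) zero = refl

⊕-comm : ∀ {D} (x y : Vec Bool D) → x ⊕ y ≡ y ⊕ x
⊕-comm [] [] = refl
⊕-comm (true  ∷ x) (true  ∷ y) = cong (_ ∷_) (⊕-comm x y)
⊕-comm (true  ∷ x) (false ∷ y) = cong (_ ∷_) (⊕-comm x y)
⊕-comm (false ∷ x) (true  ∷ y) = cong (_ ∷_) (⊕-comm x y)
⊕-comm (false ∷ x) (false ∷ y) = cong (_ ∷_) (⊕-comm x y)

⊕-cancel : ∀ {D} (x y : Vec Bool D) → (x ⊕ y) ⊕ y ≡ x
⊕-cancel [] [] = refl
⊕-cancel (true  ∷ x) (true  ∷ y) = cong (_ ∷_) (⊕-cancel x y)
⊕-cancel (true  ∷ x) (false ∷ y) = cong (_ ∷_) (⊕-cancel x y)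
⊕-cancel (false ∷ x) (true  ∷ y) = cong (_ ∷_) (⊕-cancel x y)
⊕-cancel (false ∷ x) (false ∷ y) = cong (_ ∷_) (⊕-cancel x y)

⊕-cancelˡ : ∀ {D} (a b c : Vec Bool D) → a ⊕ b ≡ a ⊕ c → b ≡ c
⊕-cancelˡ a b c e = trans (sym (⊕-cancel b a))
  (trans (cong (_⊕ a) (trans (⊕-comm b a) (trans e (⊕-comm a c)))) (⊕-cancel c a))

⊕-false : ∀ {D} (x y : Vec Bool D) {i} → (x ⊕ y) ‼ i ≡ false → x ‼ i ≡ y ‼ i
⊕-false x y {i} e rewrite lookup-zipWith _xor_ i x y with x ‼ i | y ‼ i
... | true  | true  = refl
... | false | false = refl

⊕-true : ∀ {D} (x y : Vec Bool D) {i} → (x ⊕ y) ‼ i ≡ true → x ‼ i ≢ y ‼ i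
⊕-true x y {i} e rewrite lookup-zipWith _xor_ i x y with x ‼ i | y ‼ i
... | true  | false = λ ()
... | false | true  = λ ()

≡⇒⊕ : ∀ {D} (x y : Vec Bool D) {i} → x ‼ i ≡ y ‼ i → (x ⊕ y) ‼ i ≡ false
≡⇒⊕ x y {i} e rewrite lookup-zipWith _xor_ i x y | e with y ‼ i
... | true  = refl
... | false = refl

≢⇒⊕ : ∀ {D} (x y : Vec Bool D) {i} → x ‼ i ≢ y ‼ i → (x ⊕ y) ‼ i ≡ true
≢⇒⊕ x y {i} ne with (x ⊕ y) ‼ i in e
... | true  = refl
... | false = ⊥-elim (ne (⊕-false x y e))

-- Cardinalities

∣⊹∣-in : ∀ {D} (p : Subset D) i → p ‼ i ≡ true → suc ∣ p ⊹ i ∣ ≡ ∣ p ∣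
∣⊹∣-in (true  ∷ p) zero    e = refl
∣⊹∣-in (true  ∷ p) (suc i) e = cong suc (∣⊹∣-in p i e)
∣⊹∣-in (false ∷ p) (suc i) e = ∣⊹∣-in p i e

∣⊹∣-out : ∀ {D} (p : Subset D) i → p ‼ i ≡ false → ∣ p ⊹ i ∣ ≡ suc ∣ p ∣
∣⊹∣-out (false ∷ p) zero    e = refl
∣⊹∣-out (true  ∷ p) (suc i) e = cong suc (∣⊹∣-out p i e)
∣⊹∣-out (false ∷ p) (suc i) e = ∣⊹∣-out p i e

∣p∣≡0⇒∉ : ∀ {D} (p : Subset D) → ∣ p ∣ ≡ 0 → ∀ i → p ‼ i ≡ false
∣p∣≡0⇒∉ (false ∷ p) e zero    = refl
∣p∣≡0⇒∉ (false ∷ p) e (suc i) = ∣p∣≡0⇒∉ p e i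

∣p∣≢0⇒∈ : ∀ {D} (p : Subset D) {m} → ∣ p ∣ ≡ suc m → ∃[ i ] p ‼ i ≡ true
∣p∣≢0⇒∈ (true  ∷ p) e = zero , refl
∣p∣≢0⇒∈ (false ∷ p) e with ∣p∣≢0⇒∈ p e
... | i , h = suc i , h

-- A relational form of "an injection p → q gives ∣p∣ ≤ ∣q∣".
∣∣-inject : ∀ {m n} (p : Subset m) (q : Subset n) (R : Fin m → Fin n → Set) →
  (∀ i → p ‼ i ≡ true → ∃[ j ] q ‼ j ≡ true × R i j) →
  (∀ {i i′ j} → R i j → R i′ j → i ≡ i′) → ∣ p ∣ ≤ ∣ q ∣
∣∣-inject [] q R tot inj = z≤n
∣∣-inject (false ∷ p) q R tot inj =
  ∣∣-inject p q (R ∘ suc) (tot ∘ suc) (λ r r′ → Fin.suc-injective (inj r r′))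
∣∣-inject (true ∷ p) q R tot inj with tot zero refl
... | j , qj , r₀ =
  ≤-trans (s≤s (∣∣-inject p (q ⊹ j) (R ∘ suc) tot′ (λ r r′ → Fin.suc-injective (inj r r′))))
          (≤-reflexive (∣⊹∣-in q j qj))
  where
  tot′ : ∀ i → p ‼ i ≡ true → ∃[ j′ ] (q ⊹ j) ‼ j′ ≡ true × R (suc i) j′
  tot′ i pi with tot (suc i) pi
  ... | j′ , qj′ , r with j′ ≟ j
  ... | yes refl = contradiction (inj r₀ r) λ ()
  ... | no ne = j′ , trans (⊹-off q ne) qj′ , r

⊆-∣∣ : ∀ {n} (p q : Subset n) → (∀ i → p ‼ i ≡ true → q ‼ i ≡ true) → ∣ p ∣ ≤ ∣ q ∣
⊆-∣∣ p q sub = ∣∣-inject p q _≡_ (λ i pi → i , sub i pi , refl) (λ { refl refl → refl })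

⊆-∣∣-≡ : ∀ {n} (p q : Subset n) → (∀ i → p ‼ i ≡ true → q ‼ i ≡ true) → ∣ p ∣ ≡ ∣ q ∣ → p ≡ q
⊆-∣∣-≡ p q sub e = ‼-ext same
  where
  same : ∀ i → p ‼ i ≡ q ‼ i
  same i with p ‼ i in pi | q ‼ i in qi
  ... | true  | true  = refl
  ... | false | false = refl
  ... | true  | false = trans (sym (sub i pi)) qi
  ... | false | true  = ⊥-elim (ℕ.<-irrefl e (≤-trans (s≤s (⊆-∣∣ p (q ⊹ i) sub′)) (≤-reflexive (∣⊹∣-in q i qi))))
    where
    sub′ : ∀ j → p ‼ j ≡ true → (q ⊹ i) ‼ j ≡ true
    sub′ j pj with j ≟ i
    ... | yes refl = ⊥-elim (not-≢ {true} (trans (sym pi) pj))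
    ... | no ne = trans (⊹-off q ne) (sub j pj)

-- Without `a` and `b` the two sets have equal size and one contains the other, so they coincide.
-- Applied to neighbourhoods, this is how regularity reverses an inclusion.
exchange : ∀ {n} (p q : Subset n) a b → p ‼ a ≡ true → q ‼ b ≡ true → ∣ p ∣ ≡ ∣ q ∣ →
  (∀ j → p ‼ j ≡ true → j ≢ a → q ‼ j ≡ true × j ≢ b) →
  ∀ j → q ‼ j ≡ true → j ≢ b → p ‼ j ≡ true × j ≢ a
exchange p q a b pa qb e sub j qj j≢b = trans (sym (⊹-off p j≢a)) pj , j≢a
  where
  sub′ : ∀ i → (p ⊹ a) ‼ i ≡ true → (q ⊹ b) ‼ i ≡ true
  sub′ i h with i ≟ a
  ... | yes refl = ⊥-elim (not-≢ {true} (trans (sym (trans (⊹-at p i) (cong not pa))) h))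
  ... | no ne with sub i (trans (sym (⊹-off p ne)) h) ne
  ... | qi , i≢b = trans (⊹-off q i≢b) qi
  same : p ⊹ a ≡ q ⊹ b
  same = ⊆-∣∣-≡ (p ⊹ a) (q ⊹ b) sub′ (suc-injective (trans (∣⊹∣-in p a pa) (trans e (sym (∣⊹∣-in q b qb)))))
  pj : (p ⊹ a) ‼ j ≡ true
  pj = trans (cong (_‼ j) same) (trans (⊹-off q j≢b) qj)
  j≢a : j ≢ a
  j≢a refl = not-≢ {true} (trans (sym (trans (⊹-at p j) (cong not pa))) pj)

-- Hamming distance

ham-sym : ∀ {D} (x y : Vec Bool D) → ham x y ≡ ham y x
ham-sym x y = cong ∣_∣ (⊕-comm x y)

ham-refl : ∀ {D} (x : Vec Bool D) → ham x x ≡ 0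
ham-refl [] = refl
ham-refl (true  ∷ x) = ham-refl x
ham-refl (false ∷ x) = ham-refl x

ham-0 : ∀ {D} (x y : Vec Bool D) → ham x y ≡ 0 → x ≡ y
ham-0 x y e = ‼-ext (λ j → ⊕-false x y (∣p∣≡0⇒∉ (x ⊕ y) e j))

ham-toward : ∀ {D} (x y : Vec Bool D) i → x ‼ i ≢ y ‼ i → suc (ham (x ⊹ i) y) ≡ ham x y
ham-toward x y i ne rewrite ⊕-⊹ x y i = ∣⊹∣-in (x ⊕ y) i (≢⇒⊕ x y ne)

ham-away : ∀ {D} (x y : Vec Bool D) i → x ‼ i ≡ y ‼ i → ham (x ⊹ i) y ≡ suc (ham x y)
ham-away x y i e rewrite ⊕-⊹ x y i = ∣⊹∣-out (x ⊕ y) i (≡⇒⊕ x y e)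

ham-⊹ : ∀ {D} (x : Vec Bool D) i → ham x (x ⊹ i) ≡ 1
ham-⊹ x i = trans (ham-sym x (x ⊹ i)) (trans (ham-away x x i refl) (cong suc (ham-refl x)))

ham-≢ : ∀ {D} (x y : Vec Bool D) {m} → ham x y ≡ suc m → ∃[ i ] x ‼ i ≢ y ‼ i
ham-≢ x y e with ∣p∣≢0⇒∈ (x ⊕ y) e
... | i , h = i , ⊕-true x y h

ham-1 : ∀ {D} (x y : Vec Bool D) → ham x y ≡ 1 → ∃[ i ] y ≡ x ⊹ i
ham-1 x y e with ham-≢ x y e
... | i , ne = i , sym (ham-0 (x ⊹ i) y (suc-injective (trans (ham-toward x y i ne) e)))

ham-step : ∀ {D} (x y : Vec Bool D) i → ham x y ≤ suc (ham (x ⊹ i) y)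
ham-step x y i with x ‼ i ≟ᵇ y ‼ i
... | yes e = ℕ.m≤n⇒m≤1+n (≤-trans (ℕ.n≤1+n _) (≤-reflexive (sym (ham-away x y i e))))
... | no ne = ≤-reflexive (sym (ham-toward x y i ne))

ham-triangle : ∀ {D} (x z y : Vec Bool D) → ham x y ≤ ham x z + ham z y
ham-triangle x z y = go (ham x z) x refl
  where
  go : ∀ n x → ham x z ≡ n → ham x y ≤ n + ham z y
  go zero x e = ≤-reflexive (cong (λ u → ham u y) (ham-0 x z e))
  go (suc n) x e with ham-≢ x z e
  ... | i , ne = ≤-trans (ham-step x y i) (s≤s (go n (x ⊹ i) (suc-injective (trans (ham-toward x z i ne) e))))

Between : ∀ {D} → Vec Bool D → Vec Bool D → Vec Bool D → Set
Between x z y = ∀ j → x ‼ j ≡ y ‼ j → z ‼ j ≡ x ‼ j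

-- If z disagreed with x and y where these agree, flipping z there would shorten both distances.
ham-between : ∀ {D} (x z y : Vec Bool D) → ham x z + ham z y ≤ ham x y → Between x z y
ham-between x z y le j e = decide≢ λ ne →
  ℕ.<⇒≱ (≤-trans (s≤s (≤-trans (ham-triangle x (z ⊹ j) y)
      (ℕ.+-mono-≤ (≤-trans (≤-reflexive (ham-sym x (z ⊹ j)))
                (≤-trans (ℕ.n≤1+n _) (≤-reflexive (trans (ham-toward z x j ne) (ham-sym z x)))))
                  ≤-refl)))
    (≤-trans (≤-reflexive (sym (+-suc _ _))) (ℕ.+-monoʳ-≤ (ham x z) (≤-reflexive (ham-toward z y j (≢-≡⇒≢ ne e)))))) le

⊹-conj : ∀ {D} (x : Vec Bool D) i j → x ⊹ i ⊹ j ⊹ i ≡ x ⊹ j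
⊹-conj x i j = trans (cong (_⊹ i) (⊹-comm x i j)) (⊹-inv (x ⊹ j) i)

⊹-swap₂ : ∀ {D} (x : Vec Bool D) i j k → x ⊹ i ⊹ j ⊹ k ≡ x ⊹ j ⊹ i ⊹ k
⊹-swap₂ x i j k = cong (_⊹ k) (⊹-comm x i j)

⊹-rot : ∀ {D} (x : Vec Bool D) i j k → x ⊹ i ⊹ j ⊹ k ≡ x ⊹ j ⊹ k ⊹ i
⊹-rot x i j k = trans (⊹-swap₂ x i j k) (⊹-comm (x ⊹ j) i k)

⊹-rev : ∀ {D} (x : Vec Bool D) i j k → x ⊹ i ⊹ j ⊹ k ≡ x ⊹ k ⊹ j ⊹ i
⊹-rev x i j k = trans (⊹-rot x i j k) (⊹-swap₂ x j k i)

⊹-at-≡ : ∀ {D} (x y : Vec Bool D) i → x ‼ i ≢ y ‼ i → (x ⊹ i) ‼ i ≡ y ‼ i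
⊹-at-≡ x y i ne = trans (⊹-at x i) (sym (¬-not (≢-sym ne)))

⊹-at-≢ : ∀ {D} (x y : Vec Bool D) i → x ‼ i ≡ y ‼ i → (x ⊹ i) ‼ i ≢ y ‼ i
⊹-at-≢ x y i e h = not-≢ (trans (sym (⊹-at x i)) (trans h (sym e)))

-- Isometric subsets of the cube and the descent

-- Isometry in local form: iterating the step gives a path inside `S` whose length is the Hamming
-- distance.
IsometricIn : ∀ {D} → (Vec Bool D → Set) → Set
IsometricIn {D} S = ∀ x y → S x → S y → x ≢ y → ∃[ i ] x ‼ i ≢ y ‼ i × S (x ⊹ i)

NoSquares : ∀ {D} → (Vec Bool D → Set) → Set
NoSquares {D} S = ∀ x i j → i ≢ j → S x → S (x ⊹ i) → S (x ⊹ j) → ¬ S (x ⊹ i ⊹ j)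

-- The hexagon  w, w+m, w+m+l, w+m+l+d, w+d+l, w+d  through the edge w, w+d.
record Hexagon {D} (S : Vec Bool D → Set) (w : Vec Bool D) (d m l : Fin D) : Set where
  field
    m≢l   : m ≢ l
    m≢d   : m ≢ d
    l≢d   : l ≢ d
    w+m   : S (w ⊹ m)
    w+ml  : S (w ⊹ m ⊹ l)
    w+dl  : S (w ⊹ d ⊹ l)
    w+dlm : S (w ⊹ d ⊹ l ⊹ m)

-- Any two edges of class `d` are joined by a chain of hexagons. Only the first one is recorded; its
-- edge opposite to `w` starts at `w ⊹ m ⊹ l`, two steps closer to `x`, so the chain arises by
-- iteration.
Zones : ∀ {D} → (Vec Bool D → Set) → Set
Zones {D} S = ∀ d w x → S w → S (w ⊹ d) → S x → S (x ⊹ d) → w ‼ d ≡ x ‼ d → w ≢ x →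
  ∃[ m ] ∃[ l ] Hexagon S w d m l × w ‼ m ≢ x ‼ m × w ‼ l ≢ x ‼ l

module Isometric {D} {S : Vec Bool D → Set} (iso : IsometricIn S) (no4 : NoSquares S) where

  two-step : ∀ x i j → i ≢ j → S x → S (x ⊹ i ⊹ j) → S (x ⊹ i) ⊎ S (x ⊹ j)
  two-step x i j i≢j Sx Sy
    with iso x (x ⊹ i ⊹ j) Sx Sy (λ e → ⊹-at-≢ x x i refl (trans (sym (⊹-off (x ⊹ i) i≢j)) (cong (_‼ i) (sym e))))
  ... | k , ne , Sk with k ≟ i | k ≟ j
  ... | yes refl | _ = inj₁ Sk
  ... | no _ | yes refl = inj₂ Sk
  ... | no k≢i | no k≢j = ⊥-elim (ne (sym (trans (⊹-off (x ⊹ i) k≢j) (⊹-off x k≢i))))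

  -- Some step of a geodesic has to flip `d`; the start of that step is the witness. Coordinates in
  -- which the ends agree are never flipped on the way.
  crossing : ∀ d x y → S x → S y → x ‼ d ≢ y ‼ d →
    ∃[ s ] S s × S (s ⊹ d) × s ‼ d ≡ x ‼ d × Between x s y
  crossing d x y Sx Sy ne = go (ham x y) x refl Sx ne
    where
    go : ∀ n x → ham x y ≡ n → S x → x ‼ d ≢ y ‼ d →
      ∃[ s ] S s × S (s ⊹ d) × s ‼ d ≡ x ‼ d × Between x s y
    go n x e Sx ne with iso x y Sx Sy (λ { refl → ne refl })
    go n x e Sx ne | i , xi≢yi , Si with i ≟ d
    ... | yes refl = x , Sx , Si , refl , λ _ _ → refl
    go zero x e Sx ne | i , xi≢yi , Si | no i≢d with trans (ham-toward x y i xi≢yi) e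
    ... | ()
    go (suc n) x e Sx ne | i , xi≢yi , Si | no i≢d
      with go n (x ⊹ i) (suc-injective (trans (ham-toward x y i xi≢yi) e)) Si
              (≡-≢⇒≢ (⊹-off x (≢-sym i≢d)) ne)
    ... | s , Ss , Ssd , sd , btw = s , Ss , Ssd , trans sd (⊹-off x (≢-sym i≢d)) , btw′
      where
      btw′ : Between x s y
      btw′ j xj≡yj with j ≟ i
      ... | yes refl = ⊥-elim (xi≢yi xj≡yj)
      ... | no j≢i = trans (btw j (trans (⊹-off x j≢i) xj≡yj)) (⊹-off x j≢i)

  module Hexagonal (S? : ∀ x → Dec (S x)) (zones : Zones S) (a : Fin D) where

    isolated : ∀ v b → b ≢ a → S v → S (v ⊹ a) → S (v ⊹ b) → ¬ S (v ⊹ b ⊹ a)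
    isolated v b b≢a Sv Sva Svb Svba = no4 v b a b≢a Sv Svb Sva Svba

    -- The conclusion does not depend on `b`: as squares are excluded, it amounts to
    -- `S (v ⊹ a ⊹ d)`, which follows from `q` in the same way as it would from `b`.
    pivot : ∀ v b d q → b ≢ a → q ≢ a → b ≢ d → q ≢ d → S v → S (v ⊹ a) →
      S (v ⊹ b) → S (v ⊹ b ⊹ d) → S (v ⊹ q) → S (v ⊹ q ⊹ d ⊹ a) → S (v ⊹ b ⊹ d ⊹ a)
    pivot v b d q b≢a q≢a b≢d q≢d Sv Sva Svb Svbd Svq Svqda
      with two-step (v ⊹ a) q d q≢d Sva (subst S (sym (⊹-rot v a q d)) Svqda)
    ... | inj₁ Svaq = ⊥-elim (no4 v a q (≢-sym q≢a) Sv Sva Svq Svaq)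
    ... | inj₂ Svad
      with two-step (v ⊹ b ⊹ d) b a b≢a Svbd (subst S (trans (⊹-comm v a d) (sym (cong (_⊹ a) (⊹-conj v b d)))) Svad)
    ... | inj₁ Svbdb = ⊥-elim (no4 v b d b≢d Sv Svb (subst S (⊹-conj v b d) Svbdb) Svbd)
    ... | inj₂ h = h

    Reaches : Vec Bool D → Fin D → Fin D → Vec Bool D → Set
    Reaches v b d y = S v → S (v ⊹ a) → S (v ⊹ b) → b ≢ a → S (v ⊹ b ⊹ d) → d ≢ b →
      S y → S (y ⊹ a) → y ‼ a ≡ v ‼ a → v ‼ d ≢ y ‼ d → S (v ⊹ b ⊹ d ⊹ a)

    -- A hexagon with two edges of class a, one at y and one at s; it crosses d,
    -- and s is two steps closer to v than y and on the side of v for d.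
    record Last (v y : Vec Bool D) (d g : Fin D) (s : Vec Bool D) : Set where
      field
        g≢d : g ≢ d
        y≡  : s ⊹ g ⊹ d ≡ y
        vd  : v ‼ d ≡ s ‼ d
        vg  : v ‼ g ≡ s ‼ g
        sa  : s ‼ a ≡ v ‼ a
        Ss  : S s
        Ssa : S (s ⊹ a)
        closer : suc (suc (ham v s)) ≡ ham v y
        side : S (s ⊹ d) ⊎ S (s ⊹ g)

      same : ∀ {i} → i ≢ d → i ≢ g → s ‼ i ≡ y ‼ i
      same i≢d i≢g = trans (sym (⊹-off s i≢g)) (trans (sym (⊹-off (s ⊹ g) i≢d)) (cong (_‼ _) y≡))

      s⇒y : ∀ {i} → v ‼ i ≢ s ‼ i → v ‼ i ≢ y ‼ i
      s⇒y {i} ne with i ≟ d | i ≟ g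
      ... | yes refl | _ = ⊥-elim (ne vd)
      ... | no _ | yes refl = ⊥-elim (ne vg)
      ... | no i≢d | no i≢g = ≢-≡⇒≢ ne (same i≢d i≢g)

      y⇒s : ∀ {i} → i ≢ d → i ≢ g → v ‼ i ≢ y ‼ i → v ‼ i ≢ s ‼ i
      y⇒s i≢d i≢g ne = ≢-≡⇒≢ ne (sym (same i≢d i≢g))

    module Step (n : ℕ) (IH : ∀ v b d y → ham v y < n → Reaches v b d y) where

      -- What is left to do once the first hexagon at `v ⊹ b` through its edge of class `e` is
      -- known. Either the hexagon turns back through `v`, or it moves on to `v ⊹ b ⊹ m`, which is
      -- already in U. The treatment depends on the position of `b` relative to `y` and `s`, hence
      -- the abstraction.
      Turn : Vec Bool D → Vec Bool D → Vec Bool D → Fin D → Fin D → Set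
      Turn v y s b e = ∀ m l → S (v ⊹ b ⊹ e) → Hexagon S (v ⊹ b) e m l →
        (m ≡ b × v ‼ b ≡ s ‼ b) ⊎ (m ≢ b × v ‼ m ≢ y ‼ m × S (v ⊹ b ⊹ m ⊹ a)) →
        (l ≡ b ⊎ v ‼ l ≢ y ‼ l) → S (v ⊹ b ⊹ e ⊹ a)

      module _ {v y d g s} (last : Last v y d g s) (v<y : ham v y ≤ n)
               (Sv : S v) (Sva : S (v ⊹ a)) (Sy : S y) (Sya : S (y ⊹ a)) where
        open Last last

        s<n : ham v s < n
        s<n = ≤-trans (ℕ.n≤1+n _) (≤-trans (≤-reflexive closer) v<y)

        base-case : ∀ b m → b ≢ a → S (v ⊹ b) → m ≢ b → S (v ⊹ b ⊹ m) → v ‼ m ≢ s ‼ m → S (v ⊹ b ⊹ m ⊹ a)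
        base-case b m b≢a Svb m≢b Svbm ne = IH v b m s s<n Sv Sva Svb b≢a Svbm m≢b Ss Ssa sa ne

        differ-s : ∀ b {i} → (v ⊹ b) ‼ i ≢ s ‼ i → i ≢ b → v ‼ i ≢ s ‼ i
        differ-s b ne i≢b = ≡-≢⇒≢ (sym (⊹-off v i≢b)) ne

        differ-at : ∀ b {i} → (v ⊹ b) ‼ i ≢ s ‼ i → i ≡ b → v ‼ b ≡ s ‼ b
        differ-at b ne refl = decide≢ λ h → ne (⊹-at-≡ v s b h)

        differ-y : ∀ b {i} → (v ⊹ b) ‼ i ≢ s ‼ i → i ≡ b ⊎ v ‼ i ≢ y ‼ i
        differ-y b {i} ne with i ≟ b
        ... | yes e = inj₁ e
        ... | no i≢b = inj₂ (s⇒y (differ-s b ne i≢b))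

        v+b≢s : ∀ b → b ≢ a → S (v ⊹ b) → v ⊹ b ≢ s
        v+b≢s b b≢a Svb refl = isolated v b b≢a Sv Sva Svb Ssa

        -- The class `e` is followed from `v ⊹ b` to its edge at `s`. Unless `m` is `b`, it
        -- separates `v` from `s`, and the induction hypothesis with `s` in place of `y` puts
        -- `v ⊹ b ⊹ m` into U.
        descend-s : ∀ b e → b ≢ a → e ≢ b → S (v ⊹ b) → S (v ⊹ b ⊹ e) → S (s ⊹ e) → v ‼ e ≡ s ‼ e →
          Turn v y s b e → S (v ⊹ b ⊹ e ⊹ a)
        descend-s b e b≢a e≢b Svb Svbe Sse ve turn
          with zones e (v ⊹ b) s Svb Svbe Ss Sse (trans (⊹-off v e≢b) ve) (v+b≢s b b≢a Svb)
        ... | m , l , hex , ne-m , ne-l with m ≟ b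
        ... | yes m≡b = turn m l Svbe hex (inj₁ (m≡b , differ-at b ne-m m≡b)) (differ-y b ne-l)
        ... | no m≢b = turn m l Svbe hex
                (inj₂ (m≢b , s⇒y ne , base-case b m b≢a Svb m≢b (Hexagon.w+m hex) ne)) (differ-y b ne-l)
          where ne : v ‼ m ≢ s ‼ m
                ne = differ-s b ne-m m≢b

        -- The last hexagon has an edge of class `d` at `s` or at `s ⊹ g`, according to `side`; this
        -- edge is the target to which class `d` is followed from `v ⊹ b`.
        descend : ∀ b → b ≢ a → d ≢ b → S (v ⊹ b) → S (v ⊹ b ⊹ d) → v ‼ d ≢ y ‼ d → v ‼ g ≢ y ‼ g →
          Turn v y s b d → (g ≢ b → Turn v y s b g) → S (v ⊹ b ⊹ d ⊹ a)
        descend b b≢a d≢b Svb Svbd vd≢yd vg≢yg turn-d turn-g with side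
        ... | inj₁ Ssd = descend-s b d b≢a d≢b Svb Svbd Ssd vd turn-d
        ... | inj₂ Ssg with S? (v ⊹ b ⊹ d ⊹ a)
        ... | yes h = h
        ... | no ¬h
          with zones d (v ⊹ b) (s ⊹ g) Svb Svbd Ssg (subst S (sym y≡) Sy)
                 (trans (⊹-off v d≢b) (trans vd (sym (⊹-off s (≢-sym g≢d)))))
                 -- If `v ⊹ b` were `s ⊹ g`, then `v ⊹ b ⊹ d` would be `y`, which lies in U.
                 (λ e → ¬h (subst (λ u → S (u ⊹ a)) (sym (trans (cong (_⊹ d) e) y≡)) Sya))
        ... | m , l , hex , ne-m , ne-l = finish
          where
          open Hexagon hex
          ne-y : ∀ {i} → (v ⊹ b) ‼ i ≢ (s ⊹ g) ‼ i → i ≢ d → (v ⊹ b) ‼ i ≢ y ‼ i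
          ne-y ne i≢d = ≢-≡⇒≢ ne (trans (sym (⊹-off (s ⊹ g) i≢d)) (cong (_‼ _) y≡))
          away : ∀ {i} → (v ⊹ b) ‼ i ≢ (s ⊹ g) ‼ i → i ≢ d → i ≢ b → v ‼ i ≢ y ‼ i
          away ne i≢d i≢b = ≡-≢⇒≢ (sym (⊹-off v i≢b)) (ne-y ne i≢d)
          at-b : m ≡ b → v ‼ b ≡ s ‼ b
          at-b refl with b ≟ g
          ... | yes refl = vg
          ... | no b≢g = differ-at b (≢-≡⇒≢ ne-m (⊹-off s b≢g)) refl
          l-fact : l ≡ b ⊎ v ‼ l ≢ y ‼ l
          l-fact with l ≟ b
          ... | yes e = inj₁ e
          ... | no l≢b = inj₂ (away ne-l l≢d l≢b)
          finish : S (v ⊹ b ⊹ d ⊹ a)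
          finish with m ≟ b
          ... | yes e = turn-d m l Svbd hex (inj₁ (e , at-b e)) l-fact
          ... | no m≢b with S? (v ⊹ b ⊹ m ⊹ a)
          ... | yes h = turn-d m l Svbd hex (inj₂ (m≢b , away ne-m m≢d m≢b , h)) l-fact
          ... | no ¬Um with m ≟ g
          ... | no m≢g = ⊥-elim (¬Um (base-case b m b≢a Svb m≢b w+m (y⇒s m≢d m≢g (away ne-m m≢d m≢b))))
          -- The class `g` does not separate `v` from `s`, so the induction hypothesis at `s` says
          -- nothing here. The edge of class `g` at `s` is taken as a new target.
          ... | yes refl = ⊥-elim (¬Um (descend-s b g b≢a m≢b Svb w+m Ssg vg (turn-g m≢b)))

      -- If b and m both point towards y, then v+b+m is a base of v+b from which y is nearer.
      turn-near : ∀ {v y s} b e → ham v y ≤ n → S v → S (v ⊹ a) → S y → S (y ⊹ a) → y ‼ a ≡ v ‼ a → b ≢ a →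
        S (v ⊹ b) → e ≢ b → v ‼ e ≢ y ‼ e → v ‼ b ≢ y ‼ b →
        (∀ l → S (v ⊹ b ⊹ e) → Hexagon S (v ⊹ b) e b l → v ‼ b ≡ s ‼ b → v ‼ l ≢ y ‼ l → S (v ⊹ b ⊹ e ⊹ a)) →
        Turn v y s b e
      turn-near b e v<y Sv Sva Sy Sya ya b≢a Svb e≢b ve vb rest m l Svbe hex (inj₁ (refl , vb≡sb)) (inj₁ l≡b) =
        ⊥-elim (Hexagon.m≢l hex (sym l≡b))
      turn-near b e v<y Sv Sva Sy Sya ya b≢a Svb e≢b ve vb rest m l Svbe hex (inj₁ (refl , vb≡sb)) (inj₂ vl) =
        rest l Svbe hex vb≡sb vl
      turn-near {v} {y} b e v<y Sv Sva Sy Sya ya b≢a Svb e≢b ve vb rest m l Svbe hex (inj₂ (m≢b , vm , Um)) _ =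
        subst (λ u → S (u ⊹ e ⊹ a)) (⊹-inv (v ⊹ b) m)
          (IH (v ⊹ b ⊹ m) m e y v′<n w+m Um (subst S (sym (⊹-inv (v ⊹ b) m)) Svb) m≢a
             (subst (λ u → S (u ⊹ e)) (sym (⊹-inv (v ⊹ b) m)) Svbe) (≢-sym m≢d) Sy Sya
             (trans ya (sym (trans (⊹-off (v ⊹ b) (≢-sym m≢a)) (⊹-off v (≢-sym b≢a)))))
             (≡-≢⇒≢ (trans (⊹-off (v ⊹ b) (≢-sym m≢d)) (⊹-off v e≢b)) ve))
        where
        open Hexagon hex
        m≢a : m ≢ a
        m≢a refl = vm (sym ya)
        v′<n : ham (v ⊹ b ⊹ m) y < n
        v′<n = ≤-trans (≤-trans (ℕ.n≤1+n _) (≤-reflexive (trans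
                 (cong suc (ham-toward (v ⊹ b) y m (≡-≢⇒≢ (⊹-off v m≢b) vm))) (ham-toward v y b vb)))) v<y

      last-vg : ∀ {v y d g s} → Last v y d g s → v ‼ g ≢ y ‼ g
      last-vg {v} {y} {d} {g} {s} last h = not-≢ (trans (sym (⊹-at s g))
        (trans (sym (⊹-off (s ⊹ g) g≢d)) (trans (cong (_‼ g) y≡) (trans (sym h) vg))))
        where open Last last

      -- As `b` separates `v` from `s`, no hexagon found on the way turns back through `v`; only the
      -- nearer base `v ⊹ b ⊹ m` occurs, where the induction hypothesis applies.
      reach-inner : ∀ {v y d g s} → Last v y d g s → ham v y ≤ n → ∀ b → v ‼ b ≢ s ‼ b → Reaches v b d y
      reach-inner {v} {y} {d} {g} {s} last v<y b vb≢sb Sv Sva Svb b≢a Svbd d≢b Sy Sya ya vd =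
        descend last v<y Sv Sva Sy Sya b b≢a d≢b Svb Svbd vd vg (turn d d≢b vd) (λ g≢b → turn g g≢b vg)
        where
        vg : v ‼ g ≢ y ‼ g
        vg = last-vg last
        turn : ∀ e → e ≢ b → v ‼ e ≢ y ‼ e → Turn v y s b e
        turn e e≢b ve = turn-near {s = s} b e v<y Sv Sva Sy Sya ya b≢a Svb e≢b ve (Last.s⇒y last vb≢sb)
                          (λ _ _ _ h _ → ⊥-elim (vb≢sb h))

      -- The hexagon of class `a` at `y` towards `v` yields `s`. If it avoids `d`, then `s` can
      -- replace `y`; if it crosses `d`, the separation is lost at `s` and the hexagon itself is
      -- kept.
      last-step : ∀ v d y → S v → S (v ⊹ a) → S y → S (y ⊹ a) → y ‼ a ≡ v ‼ a → v ‼ d ≢ y ‼ d →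
        (∃[ g ] ∃[ s ] Last v y d g s) ⊎
        (∃[ s ] ham v s < ham v y × S s × S (s ⊹ a) × s ‼ a ≡ v ‼ a × v ‼ d ≢ s ‼ d)
      last-step v d y Sv Sva Sy Sya ya vd with zones a y v Sy Sya Sv Sva ya (λ { refl → vd refl })
      ... | m , l , hex , ym , yl = cases
        where
        open Hexagon hex
        s : Vec Bool D
        s = y ⊹ m ⊹ l
        sa : s ‼ a ≡ v ‼ a
        sa = trans (⊹-off (y ⊹ m) (≢-sym l≢d)) (trans (⊹-off y (≢-sym m≢d)) ya)
        Ssa : S (s ⊹ a)
        Ssa = subst S (trans (⊹-rot y a l m) (⊹-swap₂ y l m a)) w+dlm
        closer : suc (suc (ham v s)) ≡ ham v y
        closer = trans (cong (2 +_) (ham-sym v s)) (trans (cong suc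
                   (ham-toward (y ⊹ m) v l (≡-≢⇒≢ (⊹-off y (≢-sym m≢l)) yl)))
                             (trans (ham-toward y v m ym) (ham-sym y v)))
        vm : v ‼ m ≡ s ‼ m
        vm = sym (trans (⊹-off (y ⊹ m) m≢l) (⊹-at-≡ y v m ym))
        vl : v ‼ l ≡ s ‼ l
        vl = sym (⊹-at-≡ (y ⊹ m) v l (≡-≢⇒≢ (⊹-off y (≢-sym m≢l)) yl))
        cases : (∃[ g ] ∃[ s ] Last v y d g s) ⊎
          (∃[ s ] ham v s < ham v y × S s × S (s ⊹ a) × s ‼ a ≡ v ‼ a × v ‼ d ≢ s ‼ d)
        cases with d ≟ m | d ≟ l
        ... | yes refl | _ = inj₁ (l , s , record
          { g≢d = ≢-sym m≢l ; y≡ = trans (cong (_⊹ d) (⊹-inv (y ⊹ d) l)) (⊹-inv y d)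
          ; vd = vm ; vg = vl ; sa = sa ; Ss = w+ml ; Ssa = Ssa ; closer = closer
          ; side = inj₂ (subst S (sym (⊹-inv (y ⊹ d) l)) w+m) })
        ... | no _ | yes refl = inj₁ (m , s , record
          { g≢d = m≢l 
          ; y≡ = trans (cong (_⊹ d) (⊹-swap₂ y m d m)) (trans (cong (_⊹ d) (⊹-inv (y ⊹ d) m)) (⊹-inv y d))
          ; vd = vl ; vg = vm ; sa = sa ; Ss = w+ml ; Ssa = Ssa ; closer = closer
          ; side = inj₁ (subst S (sym (⊹-inv (y ⊹ m) d)) w+m) })
        ... | no d≢m | no d≢l = inj₂ (s , ≤-trans (ℕ.n≤1+n _) (≤-reflexive closer) , w+ml , Ssa , sa ,
          ≢-≡⇒≢ vd (sym (trans (⊹-off (y ⊹ m) d≢l) (⊹-off y d≢m))))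

      -- A hexagon can turn back through `v` only for `b ≡ g`, the class lost in passing from `y` to
      -- `s`. Its direction `l` is then neither `d` nor `g`, hence separates `v` from `s`, and
      -- `pivot` exchanges `b` for `l`.
      reach-near : ∀ v b d y → ham v y ≤ n → v ‼ b ≢ y ‼ b → Reaches v b d y
      reach-near v b d y v<y vb Sv Sva Svb b≢a Svbd d≢b Sy Sya ya vd with last-step v d y Sv Sva Sy Sya ya vd
      ... | inj₂ (s , s<y , Ss , Ssa , sa , sd) =
        IH v b d s (≤-trans s<y v<y) Sv Sva Svb b≢a Svbd d≢b Ss Ssa sa sd
      ... | inj₁ (g , s , last) =
        descend last v<y Sv Sva Sy Sya b b≢a d≢b Svb Svbd vd vg (turn d d≢b vd (inj₁ refl))
                  (λ g≢b → turn g g≢b vg (inj₂ refl))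
        where
        vg : v ‼ g ≢ y ‼ g
        vg = last-vg last
        rest : ∀ e → e ≢ b → e ≡ d ⊎ e ≡ g →
          ∀ l → S (v ⊹ b ⊹ e) → Hexagon S (v ⊹ b) e b l → v ‼ b ≡ s ‼ b → v ‼ l ≢ y ‼ l → S (v ⊹ b ⊹ e ⊹ a)
        rest e e≢b e-dg l Svbe hex vb≡sb vl with b ≟ g
        ... | no b≢g = ⊥-elim (Last.y⇒s last (≢-sym d≢b) b≢g vb vb≡sb)
        rest e e≢b (inj₂ refl) l Svbe hex vb≡sb vl | yes refl = ⊥-elim (e≢b refl)
        rest e e≢b (inj₁ refl) l Svbe hex vb≡sb vl | yes refl =
          pivot v b d l b≢a l≢a (≢-sym d≢b) l≢d Sv Sva Svb Svbe Svl
            (reach-inner last v<y l (Last.y⇒s last l≢d (≢-sym m≢l) vl) Sv Sva Svl l≢a Svld (≢-sym l≢d) Sy Sya ya vd)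
          where
          open Hexagon hex
          Svl : S (v ⊹ l)
          Svl = subst S (cong (_⊹ l) (⊹-inv v b)) w+ml
          Svld : S (v ⊹ l ⊹ d)
          Svld = subst S (trans (cong (_⊹ b) (⊹-rot v b d l)) (trans (⊹-inv (v ⊹ d ⊹ l) b) (⊹-comm v d l))) w+dlm
          l≢a : l ≢ a
          l≢a refl = vl (sym ya)
        turn : ∀ e → e ≢ b → v ‼ e ≢ y ‼ e → e ≡ d ⊎ e ≡ g → Turn v y s b e
        turn e e≢b ve e-dg =
          turn-near {s = s} b e v<y Sv Sva Sy Sya ya b≢a Svb e≢b ve vb (rest e e≢b e-dg)

      -- Flipping `b` moves away from `y`, so `v ⊹ b ⊹ m` is as far from `y` as `v` and the
      -- induction hypothesis does not reach it. Instead `pivot` passes to the direction `l`, which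
      -- points towards `y` and is covered by `reach-near` at the same distance.
      reach-far : ∀ v b d y → ham v y ≤ n → v ‼ b ≡ y ‼ b → Reaches v b d y
      reach-far v b d y v<y vb Sv Sva Svb b≢a Svbd d≢b Sy Sya ya vd with last-step v d y Sv Sva Sy Sya ya vd
      ... | inj₂ (s , s<y , Ss , Ssa , sa , sd) =
        IH v b d s (≤-trans s<y v<y) Sv Sva Svb b≢a Svbd d≢b Ss Ssa sa sd
      ... | inj₁ (g , s , last) =
        descend last v<y Sv Sva Sy Sya b b≢a d≢b Svb Svbd vd (last-vg last) (turn d d≢b vd)
                  (λ g≢b → turn g g≢b (last-vg last))
        where
        turn : ∀ e → e ≢ b → v ‼ e ≢ y ‼ e → Turn v y s b e
        turn e e≢b ve m l Svbe hex (inj₁ (refl , _)) (inj₁ l≡b) = ⊥-elim (Hexagon.m≢l hex (sym l≡b))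
        turn e e≢b ve m l Svbe hex (inj₁ (refl , _)) (inj₂ vl) =
          pivot v b e l b≢a l≢a (≢-sym e≢b) l≢d Sv Sva Svb Svbe Svl
            (reach-near v l e y v<y vl Sv Sva Svl l≢a Svle (≢-sym l≢d) Sy Sya ya ve)
          where
          open Hexagon hex
          Svl : S (v ⊹ l)
          Svl = subst S (cong (_⊹ l) (⊹-inv v b)) w+ml
          Svle : S (v ⊹ l ⊹ e)
          Svle = subst S (trans (cong (_⊹ b) (⊹-rot v b e l)) (trans (⊹-inv (v ⊹ e ⊹ l) b) (⊹-comm v e l))) w+dlm
          l≢a : l ≢ a
          l≢a refl = vl (sym ya)
        turn e e≢b ve m l Svbe hex (inj₂ (m≢b , vm , Um)) l-fact with l ≟ b
        -- With `l ≡ b` the vertices `v`, `v ⊹ b`, `v ⊹ b ⊹ m`, `v ⊹ m` would form a square.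
        ... | yes refl = ⊥-elim (no4 v m b m≢b Sv (subst S (⊹-conj v b m) w+ml) Svb
                                  (subst S (⊹-comm v b m) w+m))
          where open Hexagon hex
        ... | no l≢b = subst (λ u → S (u ⊹ e ⊹ a)) back
            (pivot v′ m e l m≢a l≢a m≢d l≢d w+m Um
              (subst S (sym back) Svb) (subst (λ u → S (u ⊹ e)) (sym back) Svbe) w+ml
              (reach-near v′ l e y v′≤n v′l w+m Um w+ml l≢a v′le (≢-sym l≢d) Sy Sya
                (trans ya (sym (v′-off (≢-sym b≢a) (≢-sym m≢a)))) (≡-≢⇒≢ (v′-off e≢b (≢-sym m≢d)) ve)))
          where
          open Hexagon hex
          v′ : Vec Bool D
          v′ = v ⊹ b ⊹ m
          back : v′ ⊹ m ≡ v ⊹ b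
          back = ⊹-inv (v ⊹ b) m
          vl : v ‼ l ≢ y ‼ l
          vl = [ (λ l≡b → ⊥-elim (l≢b l≡b)) , id ]′ l-fact
          v′-off : ∀ {i} → i ≢ b → i ≢ m → v′ ‼ i ≡ v ‼ i
          v′-off i≢b i≢m = trans (⊹-off (v ⊹ b) i≢m) (⊹-off v i≢b)
          v′l : v′ ‼ l ≢ y ‼ l
          v′l = ≡-≢⇒≢ (v′-off l≢b (≢-sym m≢l)) vl
          l≢a : l ≢ a
          l≢a refl = vl (sym ya)
          m≢a : m ≢ a
          m≢a refl = vm (sym ya)
          v′le : S (v′ ⊹ l ⊹ e)
          v′le = subst S (⊹-rev (v ⊹ b) e l m) w+dlm
          v′≤n : ham v′ y ≤ n
          v′≤n = ≤-trans (≤-reflexive (suc-injective (trans (ham-toward (v ⊹ b) y m (≡-≢⇒≢ (⊹-off v m≢b) vm))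
                    (ham-away v y b vb)))) v<y

      reach : ∀ v b d y → ham v y ≤ n → Reaches v b d y
      reach v b d y v<y with v ‼ b ≟ᵇ y ‼ b
      ... | yes e = reach-far v b d y v<y e
      ... | no ne = reach-near v b d y v<y ne

    reaches-below : ∀ n v b d y → ham v y < n → Reaches v b d y
    reaches-below (suc n) v b d y (s≤s le) = Step.reach n (reaches-below n) v b d y le

    reaches : ∀ v b d y → Reaches v b d y
    reaches v b d y = reaches-below (suc (ham v y)) v b d y ≤-refl

-- Minimal halfspaces and regularity

Image : ∀ {n D} → (Fin n → Vec Bool D) → Vec Bool D → Set
Image f x = ∃[ u ] f u ≡ x

image? : ∀ {n D} (f : Fin n → Vec Bool D) x → Dec (Image f x)
image? f x = any? λ u → ≡-dec _≟ᵇ_ (f u) x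

mark : ∀ {m} {P : Fin m → Set} → (∀ i → Dec (P i)) → Subset m
mark P? = tabulate (does ∘ P?)

mark-in : ∀ {m} {P : Fin m → Set} (P? : ∀ i → Dec (P i)) {i} → P i → mark P? ‼ i ≡ true
mark-in P? {i} p = trans (lookup∘tabulate (does ∘ P?) i) (dec-true (P? i) p)

mark-out : ∀ {m} {P : Fin m → Set} (P? : ∀ i → Dec (P i)) {i} → mark P? ‼ i ≡ true → P i
mark-out P? {i} e with P? i | trans (sym (lookup∘tabulate (does ∘ P?) i)) e
... | yes p | _ = p

nb : ∀ {n D} → (Fin n → Vec Bool D) → Vec Bool D → Subset D
nb f x = mark (λ i → image? f (x ⊹ i))

nb-in : ∀ {n D} (f : Fin n → Vec Bool D) x {i} → Image f (x ⊹ i) → nb f x ‼ i ≡ true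
nb-in f x = mark-in (λ i → image? f (x ⊹ i))

nb-out : ∀ {n D} (f : Fin n → Vec Bool D) x {i} → nb f x ‼ i ≡ true → Image f (x ⊹ i)
nb-out f x = mark-out (λ i → image? f (x ⊹ i))

-- Condition (b) in coordinates: a path with directions i, j, l forms a hexagon with the path l, j, i.
PathsClose : ∀ {D} → (Vec Bool D → Set) → Set
PathsClose {D} S = ∀ v i j l → i ≢ j → j ≢ l → S v → S (v ⊹ i) → S (v ⊹ i ⊹ j) → S (v ⊹ i ⊹ j ⊹ l) →
  i ≢ l × S (v ⊹ l) × S (v ⊹ l ⊹ j)

∃-other : ∀ {D} (p : Subset D) c {m} → p ‼ c ≡ true → ∣ p ∣ ≡ suc (suc m) → ∃[ e ] p ‼ e ≡ true × e ≢ c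
∃-other p c pc size with ∣p∣≢0⇒∈ (p ⊹ c) (suc-injective (trans (∣⊹∣-in p c pc) size))
... | e , h with e ≟ c
... | yes refl = ⊥-elim (not-≢ {true} (trans (cong not (sym pc)) (trans (sym (⊹-at p e)) h)))
... | no e≢c = e , trans (sym (⊹-off p e≢c)) h , e≢c

module RegularHexagonal {n D} (f : Fin n → Vec Bool D) (iso : IsometricIn (Image f)) (no4 : NoSquares (Image f))
  (zones : Zones (Image f)) (k : ℕ) (regular : ∀ x → Image f x → ∣ nb f x ∣ ≡ suc (suc k)) where

  S : Vec Bool D → Set
  S = Image f

  open Isometric {S = S} iso no4
  open Hexagonal (image? f) zones using (isolated; reaches)

  -- The conclusion of `reaches` freed from the witness `y`, and on both sides of `c`.
  Carried : Fin D → Set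
  Carried c = ∀ v b d → S v → S (v ⊹ c) → S (v ⊹ b) → b ≢ c → S (v ⊹ b ⊹ d) → d ≢ b → S (v ⊹ b ⊹ d ⊹ c)

  -- A class that splits the halfspace also splits its border, stated pointwise: each value of `d`
  -- taken in the halfspace is taken on the border.
  Rich : Fin D → Bool → Set
  Rich c γ = ∀ d z → d ≢ c → S z → z ‼ c ≡ γ → ∃[ y ] S y × S (y ⊹ c) × y ‼ c ≡ γ × y ‼ d ≡ z ‼ d

  another : ∀ x c → S x → S (x ⊹ c) → ∃[ e ] S (x ⊹ e) × e ≢ c
  another x c Sx Sxc with ∃-other (nb f x) c (nb-in f x Sxc) (regular x Sx)
  ... | e , h , e≢c = e , nb-out f x h , e≢c

  carried-side : ∀ {c γ} → Rich c γ → ∀ v b d → v ‼ c ≡ γ →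
    S v → S (v ⊹ c) → S (v ⊹ b) → b ≢ c → S (v ⊹ b ⊹ d) → d ≢ b → S (v ⊹ b ⊹ d ⊹ c)
  carried-side {c} rich v b d vc Sv Svc Svb b≢c Svbd d≢b with d ≟ c
  ... | yes refl = ⊥-elim (isolated c v b b≢c Sv Svc Svb Svbd)
  -- The border vertex is chosen to agree with the end of the path in `d`; it therefore differs from
  -- `v` there, as `reaches` requires.
  ... | no d≢c with rich d (v ⊹ b ⊹ d) d≢c Svbd
                     (trans (⊹-off (v ⊹ b) (≢-sym d≢c)) (trans (⊹-off v (≢-sym b≢c)) vc))
  ... | y , Sy , Syc , yc , yd = reaches c v b d y Sv Svc Svb b≢c Svbd d≢b Sy Syc (trans yc (sym vc))
          (λ e → ⊹-at-≢ (v ⊹ b) v d (⊹-off v d≢b) (trans (sym yd) (sym e)))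

  -- Regularity turns the inclusions of neighbourhoods provided by carried-side into equalities.
  carried-opposite : ∀ {c γ} → Rich c γ → ∀ v t x → v ‼ c ≡ γ →
    S v → S (v ⊹ c) → S (v ⊹ c ⊹ t) → t ≢ c → S (v ⊹ c ⊹ t ⊹ x) → x ≢ t → S (v ⊹ c ⊹ t ⊹ x ⊹ c)
  carried-opposite {c} rich v t x vc Sv Svc Svct t≢c Svctx x≢t = Svctxc
    where
    -- Apart from the edges back to `v`, the vertices `v ⊹ b` and `v ⊹ c` have the same directions.
    spread : ∀ b → S (v ⊹ b) → b ≢ c → S (v ⊹ b ⊹ t) × t ≢ b
    spread b Svb b≢c with exchange (nb f (v ⊹ b)) (nb f (v ⊹ c)) b c
        (nb-in f (v ⊹ b) (subst S (sym (⊹-inv v b)) Sv)) (nb-in f (v ⊹ c) (subst S (sym (⊹-inv v c)) Sv))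
        (trans (regular _ Svb) (sym (regular _ Svc))) sub t (nb-in f (v ⊹ c) Svct) t≢c
      where
      sub : ∀ j → nb f (v ⊹ b) ‼ j ≡ true → j ≢ b → nb f (v ⊹ c) ‼ j ≡ true × j ≢ c
      sub j h j≢b with two-step (v ⊹ c) b j (≢-sym j≢b) Svc
            (subst S (sym (⊹-rot v c b j)) (carried-side rich v b j vc Sv Svc Svb b≢c (nb-out f (v ⊹ b) h) j≢b))
      ... | inj₁ Svcb = ⊥-elim (no4 v c b (≢-sym b≢c) Sv Svc Svb Svcb)
      ... | inj₂ Svcj = nb-in f (v ⊹ c) Svcj , λ { refl → isolated c v b b≢c Sv Svc Svb (nb-out f (v ⊹ b) h) }
    ... | h , t≢b = nb-out f (v ⊹ b) h , t≢b
    Svbtc : ∀ b → S (v ⊹ b) → b ≢ c → S (v ⊹ b ⊹ t ⊹ c)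
    Svbtc b Svb b≢c with spread b Svb b≢c
    ... | Svbt , t≢b = carried-side rich v b t vc Sv Svc Svb b≢c Svbt t≢b
    -- The same count for `v` and `v ⊹ c ⊹ t`, leaving out `c` and `t`, shows that `x` is a
    -- direction at `v`.
    around : nb f v ‼ x ≡ true × x ≢ c
    around = exchange (nb f v) (nb f (v ⊹ c ⊹ t)) c t (nb-in f v Svc)
        (nb-in f (v ⊹ c ⊹ t) (subst S (sym (⊹-inv (v ⊹ c) t)) Svc))
        (trans (regular _ Sv) (sym (regular _ Svct))) sub x (nb-in f (v ⊹ c ⊹ t) Svctx) x≢t
      where
      sub : ∀ b → nb f v ‼ b ≡ true → b ≢ c → nb f (v ⊹ c ⊹ t) ‼ b ≡ true × b ≢ t
      sub b h b≢c = nb-in f (v ⊹ c ⊹ t) (subst S (trans (⊹-rot v b t c) (⊹-swap₂ v t c b)) (Svbtc b Svb b≢c)) ,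
                    ≢-sym (proj₂ (spread b Svb b≢c))
        where Svb : S (v ⊹ b)
              Svb = nb-out f v h
    Svctxc : S (v ⊹ c ⊹ t ⊹ x ⊹ c)
    Svctxc = subst S (sym (trans (⊹-rot (v ⊹ c) t x c) (cong (_⊹ t) (⊹-conj v c x))))
        (proj₁ (spread x (nb-out f v (proj₁ around)) (proj₂ around)))

  carried : ∀ {c γ} → Rich c γ → Carried c
  carried {c} {γ} rich v b d Sv Svc Svb b≢c Svbd d≢b with v ‼ c ≟ᵇ γ
  ... | yes e = carried-side rich v b d e Sv Svc Svb b≢c Svbd d≢b
  ... | no ne = subst (λ u → S (u ⊹ b ⊹ d ⊹ c)) back
          (carried-opposite rich (v ⊹ c) b d (trans (⊹-at v c) (trans (cong not (¬-not ne)) (not-involutive γ)))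
             Svc (subst S (sym back) Sv) (subst (λ u → S (u ⊹ b)) (sym back) Svb) b≢c
             (subst (λ u → S (u ⊹ b ⊹ d)) (sym back) Svbd) d≢b)
    where
    back : v ⊹ c ⊹ c ≡ v
    back = ⊹-inv v c

  -- Membership in the border of `d` is carried over two steps. So if `x ⊹ i` is only adjacent to a
  -- border vertex, then `x` itself lies on the border or is that vertex.
  near-class : ∀ d → Carried d → ∀ v x → S v → S (v ⊹ d) → S x →
    S (x ⊹ d) ⊎ (∃[ j ] S (x ⊹ j) × S (x ⊹ j ⊹ d) × j ≢ d)
  near-class d car v x Sv Svd Sx = go (ham x v) x refl Sx
    where
    go : ∀ m x → ham x v ≡ m → S x → S (x ⊹ d) ⊎ (∃[ j ] S (x ⊹ j) × S (x ⊹ j ⊹ d) × j ≢ d)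
    go zero x e Sx rewrite ham-0 x v e = inj₁ Svd
    go (suc m) x e Sx with iso x v Sx Sv (λ { refl → ℕ.1+n≢0 (trans (sym e) (ham-refl x)) })
    ... | i , ne , Sxi with i ≟ d
    ... | yes refl = inj₁ Sxi
    ... | no i≢d with go m (x ⊹ i) (suc-injective (trans (ham-toward x v i ne) e)) Sxi
    ... | inj₁ Sxid = inj₂ (i , Sxi , Sxid , i≢d)
    ... | inj₂ (j , Sxij , Sxijd , j≢d) with i ≟ j
    ... | yes refl = inj₁ (subst (λ u → S (u ⊹ d)) (⊹-inv x i) Sxijd)
    ... | no i≢j = inj₁ (subst (λ u → S (u ⊹ d)) back
            (car (x ⊹ i ⊹ j) j i Sxij Sxijd (subst S (sym (⊹-inv (x ⊹ i) j)) Sxi) j≢d (subst S (sym back) Sx) i≢j))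
      where
      back : x ⊹ i ⊹ j ⊹ j ⊹ i ≡ x
      back = trans (cong (_⊹ i) (⊹-inv (x ⊹ i) j)) (⊹-inv x i)

  -- If `x` is off the border of `d`, some neighbour of `x` is on it, and two steps from there
  -- through `x` lead to `x ⊹ c`.
  near-edge : ∀ c d → c ≢ d → Carried d → ∀ v x → S v → S (v ⊹ d) → S x → S (x ⊹ c) →
    ∃[ p ] S p × S (p ⊹ d) × S (p ⊹ c)
  near-edge c d c≢d car v x Sv Svd Sx Sxc with near-class d car v x Sv Svd Sx
  ... | inj₁ Sxd = x , Sx , Sxd , Sxc
  ... | inj₂ (j , Sxj , Sxjd , j≢d) with j ≟ c
  ... | yes refl = x ⊹ c , Sxc , Sxjd , subst S (sym (⊹-inv x c)) Sx
  ... | no j≢c = x ⊹ c , Sxc , subst (λ u → S (u ⊹ c ⊹ d)) back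
          (car (x ⊹ j) j c Sxj Sxjd (subst S (sym back) Sx) j≢d (subst (λ u → S (u ⊹ c)) (sym back) Sxc) (≢-sym j≢c)) ,
          subst S (sym (⊹-inv x c)) Sx
    where
    back : x ⊹ j ⊹ j ≡ x
    back = ⊹-inv x j

  pick-side : ∀ d δ x → S x → S (x ⊹ d) → ∃[ z ] S z × z ‼ d ≡ δ × (∀ {i} → i ≢ d → z ‼ i ≡ x ‼ i)
  pick-side d δ x Sx Sxd with x ‼ d ≟ᵇ δ
  ... | yes e = x , Sx , e , λ _ → refl
  ... | no ne = x ⊹ d , Sxd , trans (⊹-at x d) (trans (cong not (¬-not ne)) (not-involutive δ)) , ⊹-off x

  -- An edge of class `c` with an end `p` on the border of `d` provides two quadrants, `p` and
  -- `p ⊹ d`. For the other side of `c`, a second edge at `p ⊹ c` leads back to the border; it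
  -- exists because degrees are at least two.
  quadrants : ∀ c d → c ≢ d → Carried d → ∀ v x → S v → S (v ⊹ d) → S x → S (x ⊹ c) →
    ∀ δ γ → ∃[ z ] S z × z ‼ d ≡ δ × z ‼ c ≡ γ
  quadrants c d c≢d car v x Sv Svd Sx Sxc δ γ with near-edge c d c≢d car v x Sv Svd Sx Sxc
  ... | p , Sp , Spd , Spc with p ‼ c ≟ᵇ γ
  ... | yes e with pick-side d δ p Sp Spd
  ... | z , Sz , zd , same = z , Sz , zd , trans (same c≢d) e
  quadrants c d c≢d car v x Sv Svd Sx Sxc δ γ | p , Sp , Spd , Spc | no ne
    with another (p ⊹ c) c Spc (subst S (sym (⊹-inv p c)) Sp)
  ... | e , Spce , e≢c with pick-side d δ (p ⊹ c ⊹ e) Spce (car p c e Sp Spd Spc c≢d Spce e≢c)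
  ... | z , Sz , zd , same = z , Sz , zd ,
        trans (same c≢d) (trans (⊹-off (p ⊹ c) (≢-sym e≢c))
                  (trans (⊹-at p c) (trans (cong not (¬-not ne)) (not-involutive γ))))

  half : Fin D → Bool → Subset n
  half c γ = mark (λ u → f u ‼ c ≟ᵇ γ)

  Proper : Fin D → Bool → Set
  Proper c γ = (∃[ x ] S x × x ‼ c ≡ γ) × (∃[ x ] S x × x ‼ c ≢ γ)

  Border : Fin D → Bool → Fin D → Bool → Fin n → Set
  Border c γ d δ u = S (f u ⊹ c) × f u ‼ c ≡ γ × f u ‼ d ≡ δ

  border? : ∀ c γ d δ u → Dec (Border c γ d δ u)
  border? c γ d δ u = image? f (f u ⊹ c) ×-dec (f u ‼ c ≟ᵇ γ ×-dec f u ‼ d ≟ᵇ δ)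

  -- The failure of `Rich` with explicit witnesses, decidable by search over the finite vertex set.
  Poor : Fin D → Bool → Fin D → Fin n → Set
  Poor c γ d u = d ≢ c × f u ‼ c ≡ γ × ¬ (∃[ w ] Border c γ d (f u ‼ d) w)

  poor? : ∀ c γ → Dec (∃[ d ] ∃[ u ] Poor c γ d u)
  poor? c γ = any? λ d → any? λ u →
    ¬? (d ≟ c) ×-dec (f u ‼ c ≟ᵇ γ ×-dec ¬? (any? (border? c γ d (f u ‼ d))))

  border-exists : ∀ c γ → Proper c γ → ∃[ y ] S y × S (y ⊹ c) × y ‼ c ≡ γ
  border-exists c γ ((x , Sx , xc) , (z , Sz , zc)) with crossing c x z Sx Sz (≡-≢⇒≢ xc (≢-sym zc))
  ... | s , Ss , Ssc , sc , _ = s , Ss , Ssc , trans sc xc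

  half-< : ∀ {d δ c γ} → (∀ u → f u ‼ d ≡ δ → f u ‼ c ≡ γ) → ∀ u → f u ‼ c ≡ γ → f u ‼ d ≢ δ →
    ∣ half d δ ∣ < ∣ half c γ ∣
  half-< {d} {δ} {c} {γ} sub u uc ud = ℕ.≤∧≢⇒< (⊆-∣∣ (half d δ) (half c γ) sub′)
      (λ e → ud (mark-out (λ w → f w ‼ d ≟ᵇ δ) (trans (cong (_‼ u) (⊆-∣∣-≡ (half d δ) (half c γ) sub′ e))
                (mark-in (λ w → f w ‼ c ≟ᵇ γ) uc))))
    where
    sub′ : ∀ i → half d δ ‼ i ≡ true → half c γ ‼ i ≡ true
    sub′ i h = mark-in (λ w → f w ‼ c ≟ᵇ γ) (sub i (mark-out (λ w → f w ‼ d ≟ᵇ δ) h))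

  -- A halfspace that is not rich contains a strictly smaller one, which is rich by induction,
  -- but then their classes cross.
  rich-below : ∀ m c γ → ∣ half c γ ∣ < m → Proper c γ → Rich c γ
  rich-below (suc m) c γ (s≤s le) proper@(_ , (o , So , oc)) with poor? c γ
  ... | no ¬poor = rich
    where
    rich : Rich c γ
    rich d z d≢c (u , refl) zc with any? (border? c γ d (f u ‼ d))
    ... | yes (w , Swc , wc , wd) = f w , (w , refl) , Swc , wc , wd
    ... | no ¬b = ⊥-elim (¬poor (d , u , d≢c , zc , ¬b))
  ... | yes (d , u , d≢c , uc , ¬border) with border-exists c γ proper
  ... | y , (w , refl) , Syc , yc = ⊥-elim conflict
    where
    δ : Bool
    δ = f u ‼ d
    yd : f w ‼ d ≢ δ
    yd e = ¬border (w , Syc , yc , e)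
    -- A geodesic from `f u` that left the halfspace of `c` would cross its border at a vertex with
    -- value `δ` in `d`, and there is none.
    inside : ∀ t → f t ‼ d ≡ δ → f t ‼ c ≡ γ
    inside t td = decide≢ λ tc → absurd tc
      where
      absurd : f t ‼ c ≢ γ → ⊥
      absurd tc with crossing c (f u) (f t) (u , refl) (t , refl) (≡-≢⇒≢ uc (≢-sym tc))
      ... | s , (r , refl) , Ssc , sc , btw = ¬border (r , Ssc , trans sc uc , btw d (sym td))
    proper-d : Proper d δ
    proper-d = (f u , (u , refl) , refl) , (f w , (w , refl) , yd)
    rich-d : Rich d δ
    rich-d = rich-below m d δ (≤-trans (half-< inside w yc yd) le) proper-d
    conflict : ⊥
    conflict with border-exists d δ proper-d
    ... | v , Sv , Svd , _
      with quadrants c d (≢-sym d≢c) (carried rich-d) v (f w) Sv Svd (w , refl) Syc δ (not γ)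
    ... | z , (t , refl) , zd , zc = not-≢ (trans (sym zc) (inside t zd))

  -- The edge of class `i` is carried along `j` and `l`, which yields `v ⊹ j ⊹ l`. Its common
  -- neighbour with `v` cannot be `v ⊹ j`, which would close a square, so it is `v ⊹ l`.
  paths-close : PathsClose S
  paths-close v i j l i≢j j≢l Sv Svi Svij Svijl = i≢l , closed
    where
    i≢l : i ≢ l
    i≢l refl = no4 v i j i≢j Sv Svi (subst S (⊹-conj v i j) Svijl) Svij
    rich : Rich i (v ‼ i)
    rich = rich-below _ i (v ‼ i) ≤-refl ((v , Sv , refl) , (v ⊹ i , Svi , ⊹-at-≢ v v i refl))
    Svjl : S (v ⊹ j ⊹ l)
    Svjl = subst S (trans (cong (_⊹ i) (⊹-rot v i j l)) (⊹-inv (v ⊹ j ⊹ l) i))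
             (carried rich (v ⊹ i) j l Svi (subst S (sym (⊹-inv v i)) Sv) Svij (≢-sym i≢j) Svijl (≢-sym j≢l))
    closed : S (v ⊹ l) × S (v ⊹ l ⊹ j)
    closed with two-step v j l j≢l Sv Svjl
    ... | inj₁ Svj = ⊥-elim (no4 v i j i≢j Sv Svi Svj Svij)
    ... | inj₂ Svl = Svl , subst S (⊹-comm v j l) Svjl

-- Squares, hexagons and paths of length three

coords : ∀ {D r} → Vec Bool D → (Fin r → Fin D) → Vec Bool D → Vec Bool r
coords v σ x = tabulate (λ t → (x ⊕ v) ‼ σ t)

coords-refl : ∀ {D r} v (σ : Fin r → Fin D) t → coords v σ v ‼ t ≡ false
coords-refl v σ t = trans (lookup∘tabulate _ t) (≡⇒⊕ v v refl)

coords-⊹ : ∀ {D r} v (σ : Fin r → Fin D) → Injective _≡_ _≡_ σ → ∀ x t →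
  coords v σ (x ⊹ σ t) ≡ coords v σ x ⊹ t
coords-⊹ v σ inj x t = ‼-ext same
  where
  same : ∀ s → coords v σ (x ⊹ σ t) ‼ s ≡ (coords v σ x ⊹ t) ‼ s
  same s rewrite lookup∘tabulate (λ r → ((x ⊹ σ t) ⊕ v) ‼ σ r) s | ⊕-⊹ x v (σ t) with s ≟ t
  ... | yes refl = trans (⊹-at (x ⊕ v) (σ t)) (sym (trans (⊹-at (coords v σ x) t) (cong not (lookup∘tabulate _ t))))
  ... | no s≢t = trans (⊹-off (x ⊕ v) (s≢t ∘ inj)) (sym (trans (⊹-off (coords v σ x) s≢t) (lookup∘tabulate _ s)))

zeros : ∀ {r} → Vec Bool r
zeros = tabulate (λ _ → false)

coords-zeros : ∀ {D r} v (σ : Fin r → Fin D) → coords v σ v ≡ zeros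
coords-zeros v σ = ‼-ext λ t → trans (coords-refl v σ t) (sym (lookup∘tabulate _ t))

pair-inj : ∀ {D} {i j : Fin D} → i ≢ j → Injective _≡_ _≡_ (lookup (i ∷ j ∷ []))
pair-inj i≢j {s} {t} = lookup-injective ((i≢j ∷ []) ∷ [] ∷ []) s t

triple-inj : ∀ {D} {i j l : Fin D} → i ≢ j → j ≢ l → i ≢ l → Injective _≡_ _≡_ (lookup (i ∷ j ∷ l ∷ []))
triple-inj i≢j j≢l i≢l {s} {t} = lookup-injective ((i≢j ∷ i≢l ∷ []) ∷ (j≢l ∷ []) ∷ [] ∷ []) s t

ham-triple : ∀ {D} (v : Vec Bool D) {i j l} → i ≢ j → j ≢ l → i ≢ l → ham v (v ⊹ i ⊹ j ⊹ l) ≡ 3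
ham-triple v {i} {j} {l} p q r = trans (ham-sym v _)
  (trans (ham-away (v ⊹ i ⊹ j) v l (trans (⊹-off (v ⊹ i) (≢-sym q)) (⊹-off v (≢-sym r))))
  (cong suc (trans (ham-away (v ⊹ i) v j (⊹-off v (≢-sym p)))
  (cong suc (trans (ham-away v v i refl) (cong suc (ham-refl v)))))))

module _ (G : Graph) where
  open Graph G

  adj-comm : ∀ {u v} → Adj G u v → Adj G v u
  adj-comm {u} {v} e = trans (adj-sym v u) e

  hamming≡ham : ∀ {d} (x y : Vec Bool d) → hamming G x y ≡ ham x y
  hamming≡ham [] [] = refl
  hamming≡ham (true  ∷ x) (true  ∷ y) = hamming≡ham x y
  hamming≡ham (true  ∷ x) (false ∷ y) = cong suc (hamming≡ham x y)
  hamming≡ham (false ∷ x) (true  ∷ y) = cong suc (hamming≡ham x y)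
  hamming≡ham (false ∷ x) (false ∷ y) = hamming≡ham x y

  walk-0 : ∀ {u v} → Walk G 0 u v → u ≡ v
  walk-0 w = trans (sym (Walk.start w)) (Walk.end w)

  walk-1 : ∀ {u v} → Walk G 1 u v → Adj G u v
  walk-1 w with Walk.step w 0F
  ... | e rewrite Walk.start w | Walk.end w = e

  adj-walk : ∀ {u v} → Adj G u v → Walk G 1 u v
  adj-walk {u} {v} e = record { p = lookup (u ∷ v ∷ []) ; start = refl ; end = refl ; step = λ { 0F → e } }

  walk-next : ∀ {m u v} → Walk G (suc m) u v → Fin n
  walk-next w = Walk.p w 1F

  walk-head : ∀ {m u v} (w : Walk G (suc m) u v) → Adj G u (walk-next w)
  walk-head w with Walk.step w 0F
  ... | e rewrite Walk.start w = e

  walk-tail : ∀ {m u v} (w : Walk G (suc m) u v) → Walk G m (walk-next w) v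
  walk-tail w = record { p = Walk.p w ∘ suc ; start = refl ; end = Walk.end w ; step = Walk.step w ∘ suc }

  -- What the construction of cycles from coordinates requires; shared by isometric embeddings and
  -- by isomorphisms onto two middle layers.
  record Induced {d} (φ : Fin n → Vec Bool d) : Set where
    field
      inj  : Injective _≡_ _≡_ φ
      adj⇒ : ∀ {u v} → Adj G u v → ∃[ i ] φ v ≡ φ u ⊹ i
      ⇒adj : ∀ {u v i} → φ v ≡ φ u ⊹ i → Adj G u v

  make-cycle : ∀ {ℓ} (c : ℕ → Fin n) → 2 ≤ ℓ → (∀ s t → s ≤ ℓ → t ≤ ℓ → c s ≡ c t → s ≡ t) →
    (∀ t → t < ℓ → Adj G (c t) (c (suc t))) → Adj G (c ℓ) (c 0) → Cycle G (suc ℓ)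
  make-cycle {ℓ} c ℓ≥2 c-inj step close = record
    { len≥3 = s≤s ℓ≥2 ; c = c ∘ toℕ
    ; inj = λ {i} {j} e → toℕ-injective (c-inj (toℕ i) (toℕ j) (ℕ.≤-pred (toℕ<n i)) (ℕ.≤-pred (toℕ<n j)) e)
    ; edges = edges }
    where
    edges : ∀ i j → Consecutive G i j → Adj G (c (toℕ i)) (c (toℕ j))
    edges i j (inj₁ e) = subst (λ t → Adj G (c (toℕ i)) (c t)) e
      (step (toℕ i) (ℕ.≤-pred (≤-trans (≤-reflexive (cong suc e)) (toℕ<n j))))
    edges i j (inj₂ (e , j0)) = subst (λ t → Adj G (c (toℕ i)) (c t)) (sym j0)
      (subst (λ t → Adj G (c t) (c 0)) (sym (suc-injective e)) close)

  module Embedded {d} (φ : Fin n → Vec Bool d) (induced : Induced φ) where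
    open Induced induced

    distinct : ∀ {r} v (σ : Fin r → Fin d) → ∀ {m} (c : ℕ → Fin n) (code : ℕ → Vec Bool r) (decode : Vec Bool r → ℕ) →
      (∀ t → t ≤ m → coords v σ (φ (c t)) ≡ code t) → (∀ t → t ≤ m → decode (code t) ≡ t) →
      ∀ s t → s ≤ m → t ≤ m → c s ≡ c t → s ≡ t
    distinct v σ c code decode enc dec s t s≤ t≤ e =
      trans (sym (dec s s≤)) (trans (cong decode (trans (sym (enc s s≤))
                (trans (cong (coords v σ ∘ φ) e) (enc t t≤)))) (dec t t≤))

    square : ∀ {v i j a b x y} → i ≢ j → φ a ≡ v → φ b ≡ v ⊹ i → φ x ≡ v ⊹ i ⊹ j → φ y ≡ v ⊹ j → Cycle G 4
    square {v} {i} {j} {a} {b} {x} {y} i≢j refl eb ex ey = make-cycle c (s≤s (s≤s z≤n))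
        (distinct v σ c code decode enc dec) step (⇒adj (trans (sym (⊹-inv v j)) (cong (_⊹ j) (sym ey))))
      where
      σ : Fin 2 → Fin d
      σ = lookup (i ∷ j ∷ [])
      c : ℕ → Fin n
      c 0 = a
      c 1 = b
      c 2 = x
      c _ = y
      code : ℕ → Vec Bool 2
      code 0 = zeros
      code 1 = zeros ⊹ 0F
      code 2 = zeros ⊹ 0F ⊹ 1F
      code _ = zeros ⊹ 1F
      decode : Vec Bool 2 → ℕ
      decode (false ∷ false ∷ []) = 0
      decode (true  ∷ false ∷ []) = 1
      decode (true  ∷ true  ∷ []) = 2
      decode (false ∷ true  ∷ []) = 3
      flip : ∀ z t → coords v σ (z ⊹ σ t) ≡ coords v σ z ⊹ t
      flip = coords-⊹ v σ (pair-inj i≢j)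
      enc : ∀ t → t ≤ 3 → coords v σ (φ (c t)) ≡ code t
      enc 0 _ = coords-zeros v σ
      enc 1 _ = trans (cong (coords v σ) eb) (trans (flip v 0F) (cong (_⊹ 0F) (coords-zeros v σ)))
      enc 2 _ = trans (cong (coords v σ) ex) (trans (flip (v ⊹ i) 1F)
                  (cong (_⊹ 1F) (trans (flip v 0F) (cong (_⊹ 0F) (coords-zeros v σ)))))
      enc 3 _ = trans (cong (coords v σ) ey) (trans (flip v 1F) (cong (_⊹ 1F) (coords-zeros v σ)))
      enc (suc (suc (suc (suc t)))) (s≤s (s≤s (s≤s ())))
      dec : ∀ t → t ≤ 3 → decode (code t) ≡ t
      dec 0 _ = refl
      dec 1 _ = refl
      dec 2 _ = refl
      dec 3 _ = refl
      dec (suc (suc (suc (suc t)))) (s≤s (s≤s (s≤s ())))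
      step : ∀ t → t < 3 → Adj G (c t) (c (suc t))
      step 0 _ = ⇒adj eb
      step 1 _ = ⇒adj (trans ex (cong (_⊹ j) (sym eb)))
      step 2 _ = adj-comm (⇒adj (trans ex (trans (⊹-comm v i j) (cong (_⊹ i) (sym ey)))))
      step (suc (suc (suc t))) (s≤s (s≤s (s≤s ())))

    module Triple (v : Vec Bool d) {i j l} (i≢j : i ≢ j) (j≢l : j ≢ l) (i≢l : i ≢ l)
                  {a b x y z w} (ea : φ a ≡ v) (eb : φ b ≡ v ⊹ i) (ex : φ x ≡ v ⊹ i ⊹ j)
                  (ey : φ y ≡ v ⊹ i ⊹ j ⊹ l) (ez : φ z ≡ v ⊹ l ⊹ j) (ew : φ w ≡ v ⊹ l) where
      σ : Fin 3 → Fin d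
      σ = lookup (i ∷ j ∷ l ∷ [])
      c : ℕ → Fin n
      c 0 = a
      c 1 = b
      c 2 = x
      c 3 = y
      c 4 = z
      c _ = w
      code : ℕ → Vec Bool 3
      code 0 = zeros
      code 1 = zeros ⊹ 0F
      code 2 = zeros ⊹ 0F ⊹ 1F
      code 3 = zeros ⊹ 0F ⊹ 1F ⊹ 2F
      code 4 = zeros ⊹ 2F ⊹ 1F
      code _ = zeros ⊹ 2F
      decode : Vec Bool 3 → ℕ
      decode (false ∷ false ∷ false ∷ []) = 0
      decode (true  ∷ false ∷ false ∷ []) = 1
      decode (true  ∷ true  ∷ false ∷ []) = 2
      decode (true  ∷ true  ∷ true  ∷ []) = 3
      decode (false ∷ true  ∷ true  ∷ []) = 4
      -- Catches the code of position 5; the two other vectors that end up here are not codes.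
      decode (_     ∷ _     ∷ _     ∷ []) = 5
      flip : ∀ u t {e} → coords v σ u ≡ e → coords v σ (u ⊹ σ t) ≡ e ⊹ t
      flip u t h = trans (coords-⊹ v σ (triple-inj i≢j j≢l i≢l) u t) (cong (_⊹ t) h)
      enc : ∀ t → t ≤ 5 → coords v σ (φ (c t)) ≡ code t
      enc 0 _ = trans (cong (coords v σ) ea) (coords-zeros v σ)
      enc 1 _ = trans (cong (coords v σ) eb) (flip v 0F (coords-zeros v σ))
      enc 2 _ = trans (cong (coords v σ) ex) (flip (v ⊹ i) 1F (flip v 0F (coords-zeros v σ)))
      enc 3 _ = trans (cong (coords v σ) ey) (flip (v ⊹ i ⊹ j) 2F (flip (v ⊹ i) 1F (flip v 0F (coords-zeros v σ))))
      enc 4 _ = trans (cong (coords v σ) ez) (flip (v ⊹ l) 1F (flip v 2F (coords-zeros v σ)))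
      enc 5 _ = trans (cong (coords v σ) ew) (flip v 2F (coords-zeros v σ))
      enc (suc (suc (suc (suc (suc (suc t)))))) (s≤s (s≤s (s≤s (s≤s (s≤s ())))))
      dec : ∀ t → t ≤ 5 → decode (code t) ≡ t
      dec 0 _ = refl
      dec 1 _ = refl
      dec 2 _ = refl
      dec 3 _ = refl
      dec 4 _ = refl
      dec 5 _ = refl
      dec (suc (suc (suc (suc (suc (suc t)))))) (s≤s (s≤s (s≤s (s≤s (s≤s ())))))
      step : ∀ t → t < 5 → Adj G (c t) (c (suc t))
      step 0 _ = ⇒adj (trans eb (cong (_⊹ i) (sym ea)))
      step 1 _ = ⇒adj (trans ex (cong (_⊹ j) (sym eb)))
      step 2 _ = ⇒adj (trans ey (cong (_⊹ l) (sym ex)))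
      step 3 _ = adj-comm (⇒adj (trans ey (trans (⊹-rot v i j l) (trans (⊹-swap₂ v j l i) (cong (_⊹ i) (sym ez))))))
      step 4 _ = adj-comm (⇒adj (trans ez (cong (_⊹ j) (sym ew))))
      step (suc (suc (suc (suc (suc t))))) (s≤s (s≤s (s≤s (s≤s (s≤s ())))))

      c-inj : ∀ s t → s ≤ 5 → t ≤ 5 → c s ≡ c t → s ≡ t
      c-inj = distinct v σ c code decode enc dec

      hexagon : Cycle G 6
      hexagon = make-cycle c (s≤s (s≤s z≤n)) c-inj step (adj-comm (⇒adj (trans ew (cong (_⊹ l) (sym ea)))))

    path-directions : ∀ {u v} (w : Walk G 3 u v) → IsPath G w →
      ∃[ i ] ∃[ j ] ∃[ l ] i ≢ j × j ≢ l × φ (Walk.p w 1F) ≡ φ (Walk.p w 0F) ⊹ i ×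
        φ (Walk.p w 2F) ≡ φ (Walk.p w 0F) ⊹ i ⊹ j × φ (Walk.p w 3F) ≡ φ (Walk.p w 0F) ⊹ i ⊹ j ⊹ l
    path-directions w path with adj⇒ (Walk.step w 0F) | adj⇒ (Walk.step w 1F) | adj⇒ (Walk.step w 2F)
    ... | i , e1 | j , e2 | l , e3 = i , j , l ,
        (λ { refl → turn-back 2F 0F (λ ()) (trans e2 (trans (cong (_⊹ i) e1) (⊹-inv _ i))) }) ,
        (λ { refl → turn-back 3F 1F (λ ()) (trans e3 (trans (cong (_⊹ j) e2) (⊹-inv _ j))) }) ,
        e1 , trans e2 (cong (_⊹ j) e1) , trans e3 (cong (_⊹ l) (trans e2 (cong (_⊹ j) e1)))
      where
      turn-back : ∀ s t → s ≢ t → φ (Walk.p w s) ≢ φ (Walk.p w t)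
      turn-back s t s≢t e = s≢t (path (inj e))

    paths-close⇒P3InC6 : PathsClose (Image φ) → P3InC6 G
    paths-close⇒P3InC6 close u v w path with path-directions w path
    ... | i , j , l , i≢j , j≢l , e1 , e2 , e3
      with close (φ (Walk.p w 0F)) i j l i≢j j≢l (_ , refl) (_ , e1) (_ , e2) (_ , e3)
    ... | i≢l , (q , eq) , (r , er) = hexagon , on , along
      where
      open Triple (φ (Walk.p w 0F)) i≢j j≢l i≢l refl e1 e2 e3 er eq
      on : ∀ t → OnCycle G hexagon (Walk.p w t)
      on 0F = 0F , refl
      on 1F = 1F , refl
      on 2F = 2F , refl
      on 3F = 3F , refl
      along : ∀ t → CycleEdge G hexagon (Walk.p w (inject₁ t)) (Walk.p w (suc t))
      along 0F = 0F , 1F , inj₁ refl , inj₁ (refl , refl)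
      along 1F = 1F , 2F , inj₁ refl , inj₁ (refl , refl)
      along 2F = 2F , 3F , inj₁ refl , inj₁ (refl , refl)

-- Going around a hexagon in either direction

next previous : Fin 6 → Fin 6
next 0F = 1F
next 1F = 2F
next 2F = 3F
next 3F = 4F
next 4F = 5F
next 5F = 0F
previous 0F = 5F
previous 1F = 0F
previous 2F = 1F
previous 3F = 2F
previous 4F = 3F
previous 5F = 4F

-- A sense of rotation in the abstract, so that one argument serves both orientations.
record Rotation (t t⁻ : Fin 6 → Fin 6) : Set where
  field
    inverse  : ∀ s → t⁻ (t s) ≡ s
    order-6  : ∀ s → t (t (t (t (t (t s))))) ≡ s
    distinct : ∀ s → t (t (t (t (t s)))) ≢ t s

forward : Rotation next previous
forward = record
  { inverse  = λ { 0F → refl ; 1F → refl ; 2F → refl ; 3F → refl ; 4F → refl ; 5F → refl }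
  ; order-6  = λ { 0F → refl ; 1F → refl ; 2F → refl ; 3F → refl ; 4F → refl ; 5F → refl }
  ; distinct = λ { 0F () ; 1F () ; 2F () ; 3F () ; 4F () ; 5F () } }

backward : Rotation previous next
backward = record
  { inverse  = λ { 0F → refl ; 1F → refl ; 2F → refl ; 3F → refl ; 4F → refl ; 5F → refl }
  ; order-6  = λ { 0F → refl ; 1F → refl ; 2F → refl ; 3F → refl ; 4F → refl ; 5F → refl }
  ; distinct = λ { 0F () ; 1F () ; 2F () ; 3F () ; 4F () ; 5F () } }

module HexagonWalk (G : Graph) (C : Cycle G 6) where
  open Graph G
  open Cycle C

  consecutive-next : ∀ i j → Consecutive G i j → j ≡ next i
  consecutive-next 0F j (inj₁ e) = toℕ-injective (sym e)
  consecutive-next 1F j (inj₁ e) = toℕ-injective (sym e)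
  consecutive-next 2F j (inj₁ e) = toℕ-injective (sym e)
  consecutive-next 3F j (inj₁ e) = toℕ-injective (sym e)
  consecutive-next 4F j (inj₁ e) = toℕ-injective (sym e)
  consecutive-next 5F j (inj₁ e) = ⊥-elim (ℕ.<-irrefl (sym e) (toℕ<n j))
  consecutive-next 5F j (inj₂ (_ , e)) = toℕ-injective e

  next-adj : ∀ s → Adj G (c s) (c (next s))
  next-adj 0F = edges 0F 1F (inj₁ refl)
  next-adj 1F = edges 1F 2F (inj₁ refl)
  next-adj 2F = edges 2F 3F (inj₁ refl)
  next-adj 3F = edges 3F 4F (inj₁ refl)
  next-adj 4F = edges 4F 5F (inj₁ refl)
  next-adj 5F = edges 5F 0F (inj₂ (refl , refl))

  previous-adj : ∀ s → Adj G (c s) (c (previous s))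
  previous-adj s = adj-comm G (subst (λ t → Adj G (c (previous s)) (c t)) (Rotation.inverse backward s)
            (next-adj (previous s)))

  cycle-neighbour : ∀ {x y} s → c s ≡ x → CycleEdge G C x y → y ≡ c (next s) ⊎ y ≡ c (previous s)
  cycle-neighbour s e (i , j , con , inj₁ (ci , cj)) with inj (trans e (sym ci)) | consecutive-next i j con
  ... | refl | refl = inj₁ (sym cj)
  cycle-neighbour s e (i , j , con , inj₂ (ci , cj)) with inj (trans e (sym cj)) | consecutive-next i j con
  ... | refl | refl = inj₂ (trans (sym ci) (cong c (sym (Rotation.inverse forward i))))

  -- A path that never turns back keeps its sense of rotation, so it covers half of the hexagon; `q`
  -- and `r` are the inner vertices of the other half.
  opposite-path : ∀ {x₀ x₁ x₂ x₃} → OnCycle G C x₀ → x₀ ≢ x₂ → x₁ ≢ x₃ →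
    CycleEdge G C x₀ x₁ → CycleEdge G C x₁ x₂ → CycleEdge G C x₂ x₃ →
    ∃[ q ] ∃[ r ] q ≢ x₁ × Adj G x₀ q × Adj G q r × Adj G r x₃
  opposite-path {x₀} {x₁} {x₂} {x₃} (s , refl) ne₀ ne₁ e₀ e₁ e₂ =
    [ turn next previous forward (λ s e → cycle-neighbour s e) next-adj
    , turn previous next backward (λ s e h → [ inj₂ , inj₁ ]′ (cycle-neighbour s e h)) previous-adj
    ]′ (cycle-neighbour s refl e₀)
    where
    turn : ∀ t t⁻ → Rotation t t⁻ → (∀ {x y} s → c s ≡ x → CycleEdge G C x y → y ≡ c (t s) ⊎ y ≡ c (t⁻ s)) →
      (∀ s → Adj G (c s) (c (t s))) → x₁ ≡ c (t s) →
      ∃[ q ] ∃[ r ] q ≢ x₁ × Adj G (c s) q × Adj G q r × Adj G r x₃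
    turn t t⁻ rot nbr step refl with nbr (t s) refl e₁
    ... | inj₂ refl = ⊥-elim (ne₀ (cong c (sym (Rotation.inverse rot s))))
    ... | inj₁ refl with nbr (t (t s)) refl e₂
    ... | inj₂ refl = ⊥-elim (ne₁ (cong c (sym (Rotation.inverse rot (t s)))))
    ... | inj₁ refl = c (t (t (t (t (t s))))) , c (t (t (t (t s)))) ,
          (λ e → Rotation.distinct rot s (inj e)) ,
          adj-comm G (subst (λ u → Adj G (c (t (t (t (t (t s)))))) (c u)) (Rotation.order-6 rot s) (step _)) ,
          adj-comm G (step _) , adj-comm G (step _)

module Closing (G : Graph) {d} (φ : Fin (Graph.n G) → Vec Bool d) (induced : Induced G φ)
               (no4 : NoSquares (Image φ)) where
  open Graph G
  open Induced induced

  adj-ham : ∀ {u v} → Adj G u v → ham (φ u) (φ v) ≡ 1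
  adj-ham {u} e with adj⇒ e
  ... | i , eq = trans (cong (ham (φ u)) eq) (ham-⊹ (φ u) i)

  differ-triple : ∀ (v : Vec Bool d) i j l m → v ‼ m ≢ (v ⊹ i ⊹ j ⊹ l) ‼ m → m ≡ i ⊎ m ≡ j ⊎ m ≡ l
  differ-triple v i j l m ne with m ≟ i | m ≟ j | m ≟ l
  ... | yes e | _ | _ = inj₁ e
  ... | no _ | yes e | _ = inj₂ (inj₁ e)
  ... | no _ | no _ | yes e = inj₂ (inj₂ e)
  ... | no m≢i | no m≢j | no m≢l =
    ⊥-elim (ne (sym (trans (⊹-off (v ⊹ i ⊹ j) m≢l) (trans (⊹-off (v ⊹ i) m≢j) (⊹-off v m≢i)))))

  -- The neighbour `q` of `a` on the other half of the hexagon is two steps from `y`, so its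
  -- direction is `i`, `j` or `l`. It is not `i`, as `q` is not `b`, and `j` would close a square.
  P3InC6⇒paths-close : IsometricIn (Image φ) → P3InC6 G → PathsClose (Image φ)
  P3InC6⇒paths-close iso p3 v i j l i≢j j≢l (a , ea) (b , eb) (x , ex) (y , ey) = i≢l , closed
    where
    open Isometric {S = Image φ} iso no4
    i≢l : i ≢ l
    i≢l refl = no4 v i j i≢j (a , ea) (b , eb) (y , trans ey (⊹-conj v i j)) (x , ex)
    φ-≢ : ∀ {p q} m → φ p ‼ m ≢ φ q ‼ m → p ≢ q
    φ-≢ m ne refl = ne refl
    ‼≢ : ∀ {u w : Vec Bool d} m → u ‼ m ≡ v ‼ m → w ‼ m ≡ not (v ‼ m) → u ‼ m ≢ w ‼ m
    ‼≢ m e e′ h = not-≢ (trans (sym e′) (trans (sym h) e))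
    ai : φ a ‼ i ≡ v ‼ i
    ai = cong (_‼ i) ea
    bi : φ b ‼ i ≡ not (v ‼ i)
    bi = trans (cong (_‼ i) eb) (⊹-at v i)
    xi : φ x ‼ i ≡ not (v ‼ i)
    xi = trans (cong (_‼ i) ex) (trans (⊹-off (v ⊹ i) i≢j) (⊹-at v i))
    yi : φ y ‼ i ≡ not (v ‼ i)
    yi = trans (cong (_‼ i) ey) (trans (⊹-off (v ⊹ i ⊹ j) i≢l) (trans (⊹-off (v ⊹ i) i≢j) (⊹-at v i)))
    bj : φ b ‼ j ≡ v ‼ j
    bj = trans (cong (_‼ j) eb) (⊹-off v (≢-sym i≢j))
    xj : φ x ‼ j ≡ not (v ‼ j)
    xj = trans (cong (_‼ j) ex) (trans (⊹-at (v ⊹ i) j) (cong not (⊹-off v (≢-sym i≢j))))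
    yj : φ y ‼ j ≡ not (v ‼ j)
    yj = trans (cong (_‼ j) ey) (trans (⊹-off (v ⊹ i ⊹ j) j≢l)
              (trans (⊹-at (v ⊹ i) j) (cong not (⊹-off v (≢-sym i≢j)))))
    x≢y : x ≢ y
    x≢y refl = ⊹-≢ (v ⊹ i ⊹ j) l (trans (sym ey) ex)
    a≢x : a ≢ x
    a≢x = φ-≢ i (‼≢ {φ a} {φ x} i ai xi)
    b≢y : b ≢ y
    b≢y = φ-≢ j (‼≢ {φ b} {φ y} j bj yj)
    vertices : Unique (a ∷ b ∷ x ∷ y ∷ [])
    vertices = (φ-≢ i (‼≢ {φ a} {φ b} i ai bi) ∷ a≢x ∷ φ-≢ i (‼≢ {φ a} {φ y} i ai yi) ∷ []) ∷
               (φ-≢ j (‼≢ {φ b} {φ x} j bj xj) ∷ b≢y ∷ []) ∷ (x≢y ∷ []) ∷ [] ∷ []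
    walk : Walk G 3 a y
    walk = record { p = lookup (a ∷ b ∷ x ∷ y ∷ []) ; start = refl ; end = refl ; step = λ
      { 0F → ⇒adj (trans eb (cong (_⊹ i) (sym ea)))
      ; 1F → ⇒adj (trans ex (cong (_⊹ j) (sym eb)))
      ; 2F → ⇒adj (trans ey (cong (_⊹ l) (sym ex))) } }
    direction : ∀ {q r} m → Adj G q r → Adj G r y → φ q ≡ φ a ⊹ m → m ≡ i ⊎ m ≡ j ⊎ m ≡ l
    direction {q} {r} m qr ry eq = differ-triple v i j l m λ e → ℕ.<⇒≱
      (s≤s (≤-trans (ham-triangle (φ q) (φ r) (φ y))
                    (≤-trans (≤-reflexive (cong₂ _+_ (adj-ham qr) (adj-ham ry))) (ℕ.n≤1+n 2))))
      (≤-reflexive (sym (trans (cong₂ ham (trans eq (cong (_⊹ m) ea)) ey)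
        (trans (ham-away v (v ⊹ i ⊹ j ⊹ l) m e) (cong suc (ham-triple v i≢j j≢l i≢l))))))
    new-vertex : ∀ {q m} → q ≢ b → φ q ≡ φ a ⊹ m → m ≡ i ⊎ m ≡ j ⊎ m ≡ l → Image φ (v ⊹ l)
    new-vertex q≢b eq (inj₁ refl) = ⊥-elim (q≢b (inj (trans eq (trans (cong (_⊹ i) ea) (sym eb)))))
    new-vertex {q} q≢b eq (inj₂ (inj₁ refl)) =
      ⊥-elim (no4 v i j i≢j (a , ea) (b , eb) (q , trans eq (cong (_⊹ j) ea)) (x , ex))
    new-vertex {q} q≢b eq (inj₂ (inj₂ refl)) = q , trans eq (cong (_⊹ l) ea)
    Svl : Image φ (v ⊹ l)
    Svl =
      let C , on , along = p3 a y walk (λ {s} {t} → lookup-injective vertices s t)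
          q , r , q≢b , aq , qr , ry =
            HexagonWalk.opposite-path G C (on 0F) a≢x b≢y (along 0F) (along 1F) (along 2F)
          m , eq = adj⇒ aq
      in new-vertex q≢b eq (direction m qr ry eq)
    closed : Image φ (v ⊹ l) × Image φ (v ⊹ l ⊹ j)
    closed = Svl , [ (λ Svli → ⊥-elim (no4 v l i (≢-sym i≢l) (a , ea) Svl (b , eb) Svli)) , id ]′
      (two-step (v ⊹ l) i j i≢j Svl (y , trans ey (trans (⊹-comm (v ⊹ i) j l) (cong (_⊹ j) (⊹-comm v i l)))))

-- Partial cubes and convex cycles

∣∣-≥2 : ∀ {m} (p : Subset m) {i j} → i ≢ j → p ‼ i ≡ true → p ‼ j ≡ true → ∃[ r ] ∣ p ∣ ≡ suc (suc r)
∣∣-≥2 p {i} {j} i≢j pi pj = ∣ p ⊹ i ⊹ j ∣ , sym (trans (cong suc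
          (∣⊹∣-in (p ⊹ i) j (trans (⊹-off p (≢-sym i≢j)) pj))) (∣⊹∣-in p i pi))

module PartialCubes (G : Graph) {d} (f : Fin (Graph.n G) → Vec Bool d)
                    (dist : ∀ u v → Dist G u v (hamming G (f u) (f v))) where
  open Graph G

  ham≤walk : ∀ {m u v} → Walk G m u v → ham (f u) (f v) ≤ m
  ham≤walk {m} {u} {v} w = ≤-trans (≤-reflexive (sym (hamming≡ham G (f u) (f v)))) (proj₂ (dist u v) m w)

  shortest : ∀ u v → Walk G (ham (f u) (f v)) u v
  shortest u v = subst (λ m → Walk G m u v) (hamming≡ham G (f u) (f v)) (proj₁ (dist u v))

  ham-shortest : ∀ u v → Dist G u v (ham (f u) (f v))
  ham-shortest u v = shortest u v , λ m w → ham≤walk w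

  embedding-injective : Injective _≡_ _≡_ f
  embedding-injective {u} {v} e =
    walk-0 G (subst (λ m → Walk G m u v) (trans (cong (ham (f u)) (sym e)) (ham-refl (f u))) (shortest u v))

  adjacent⇒ham-1 : ∀ {u v} → Adj G u v → ham (f u) (f v) ≡ 1
  adjacent⇒ham-1 {u} {v} uv with ham (f u) (f v) in e | ham≤walk (adj-walk G uv)
  ... | 1 | _ = refl
  ... | zero | _ with embedding-injective (ham-0 (f u) (f v) e)
  ... | refl with trans (sym uv) (adj-irr u)
  ... | ()
  adjacent⇒ham-1 uv | suc (suc m) | s≤s ()

  induced : Induced G f
  induced = record
    { inj = embedding-injective
    ; adj⇒ = λ {u} {v} uv → ham-1 (f u) (f v) (adjacent⇒ham-1 uv)
    ; ⇒adj = λ {u} {v} {i} e → walk-1 G (subst (λ m → Walk G m u v) (trans (cong (ham (f u)) e) (ham-⊹ (f u) i))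
              (shortest u v)) }

  open Induced induced using (adj⇒; ⇒adj)

  isometric : IsometricIn (Image f)
  isometric _ _ (u , refl) (v , refl) u≢v with ham (f u) (f v) in e | shortest u v
  ... | zero | _ = ⊥-elim (u≢v (ham-0 (f u) (f v) e))
  ... | suc m | w with adj⇒ (walk-head G w)
  ... | i , eq = i , (λ same → ℕ.<⇒≱ (s≤s (≤-trans (ℕ.n≤1+n m) (≤-reflexive (sym e))))
            (≤-trans (≤-reflexive (trans (sym (ham-away (f u) (f v) i same)) (cong (λ x → ham x (f v)) (sym eq))))
                     (ham≤walk (walk-tail G w)))) ,
          (walk-next G w , eq)

  no-squares : ¬ Cycle G 4 → NoSquares (Image f)
  no-squares ¬C v i j i≢j (a , ea) (b , eb) (y , ey) (x , ex) =
    ¬C (Embedded.square G f induced i≢j ea eb ex ey)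

  neighbours≡degree : ∀ u → ∣ nb f (f u) ∣ ≡ degree G u
  neighbours≡degree u = ℕ.≤-antisym
    (∣∣-inject (nb f (f u)) (tabulate (adj u)) (λ i w → f w ≡ f u ⊹ i)
      (λ i h → let w , e = nb-out f (f u) h in w , trans (lookup∘tabulate (adj u) w) (⇒adj e) , e)
      (λ {i} {i′} e e′ → ⊹-dir (f u) i i′ (trans (sym e) e′)))
    (∣∣-inject (tabulate (adj u)) (nb f (f u)) (λ w i → f w ≡ f u ⊹ i)
      (λ w h → let i , e = adj⇒ (trans (sym (lookup∘tabulate (adj u) w)) h) in i , nb-in f (f u) (w , e) , e)
      (λ e e′ → embedding-injective (trans e (sym e′))))

  cycle-degree : ∀ {k} → Regular G k → Cycle G 6 → ∃[ r ] k ≡ suc (suc r)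
  cycle-degree regular C with adj⇒ (Cycle.edges C 0F 1F (inj₁ refl)) | adj⇒
            (adj-comm G (Cycle.edges C 5F 0F (inj₂ (refl , refl))))
  ... | i , e | j , e′ with ∣∣-≥2 (nb f (f (Cycle.c C 0F))) {i} {j}
          (λ { refl → contradiction (Cycle.inj C {1F} {5F} (embedding-injective (trans e (sym e′)))) λ () })
          (nb-in f _ (_ , e)) (nb-in f _ (_ , e′))
  ... | r , size = r , trans (sym (regular _)) (trans (sym (neighbours≡degree _)) size)

  -- The numbers `a` and `b` are the lengths of the two pieces into which vertex `i` cuts the walk.
  walk-between : ∀ {m u v} (w : Walk G m u v) i →
    ∃[ a ] ∃[ b ] a + b ≡ m × ham (f u) (f (Walk.p w i)) ≤ a × ham (f (Walk.p w i)) (f v) ≤ b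
  walk-between {m} {u} {v} w zero = 0 , m , refl ,
    ≤-reflexive (trans (cong (λ x → ham (f u) (f x)) (Walk.start w)) (ham-refl (f u))) ,
    ≤-trans (≤-reflexive (cong (λ x → ham (f x) (f v)) (Walk.start w))) (ham≤walk w)
  walk-between {suc m} {u} {v} w (suc i) =
    let a , b , sum , le , le′ = walk-between (walk-tail G w) i
    in suc a , b , cong suc sum ,
       ≤-trans (ham-triangle (f u) (f (walk-next G w)) (f (Walk.p w (suc i))))
         (ℕ.+-mono-≤ (≤-reflexive (adjacent⇒ham-1 (walk-head G w))) le) ,
       le′

  shortest-between : ∀ {m u v} (w : Walk G m u v) → IsShortest G w → ∀ i → Between (f u) (f (Walk.p w i)) (f v)
  shortest-between {m} {u} {v} w (_ , minimal) i =
    let a , b , sum , le , le′ = walk-between w i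
    in ham-between (f u) (f (Walk.p w i)) (f v)
         (≤-trans (ℕ.+-mono-≤ le le′) (≤-trans (≤-reflexive sum) (minimal _ (shortest u v))))

  -- Indexed by natural numbers, which keeps the concatenation of two geodesics simple; values past
  -- the end are unspecified.
  record Geodesic (u v : Fin n) : Set where
    field
      at     : ℕ → Fin n
      at-0   : at 0 ≡ u
      at-end : at (ham (f u) (f v)) ≡ v
      step   : ∀ t → t < ham (f u) (f v) → Adj G (at t) (at (suc t))

    before : ∀ t → t ≤ ham (f u) (f v) → ham (f u) (f (at t)) ≤ t
    before zero le = ≤-reflexive (trans (cong (λ x → ham (f u) (f x)) at-0) (ham-refl (f u)))
    before (suc t) le = ≤-trans (ham-triangle (f u) (f (at t)) (f (at (suc t))))
      (≤-trans (ℕ.+-mono-≤ (before t (ℕ.<⇒≤ le)) (≤-reflexive (adjacent⇒ham-1 (step t le))))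
               (≤-reflexive (ℕ.+-comm t 1)))

    after : ∀ r t → t + r ≡ ham (f u) (f v) → ham (f (at t)) (f v) ≤ r
    after zero t e = ≤-reflexive (trans (cong (λ x → ham (f x) (f v))
      (trans (cong at (trans (sym (ℕ.+-identityʳ t)) e)) at-end)) (ham-refl (f v)))
    after (suc r) t e = ≤-trans (ham-triangle (f (at t)) (f (at (suc t))) (f v))
      (ℕ.+-mono-≤ (≤-reflexive (adjacent⇒ham-1 (step t (≤-trans (ℕ.m≤m+n (suc t) r)
                (≤-reflexive (trans (sym (+-suc t r)) e))))))
                  (after r (suc t) (trans (sym (+-suc t r)) e)))

    ham-at : ∀ t → t ≤ ham (f u) (f v) → ham (f u) (f (at t)) ≡ t
    ham-at t le = ℕ.≤-antisym (before t le)
      (ℕ.+-cancelʳ-≤ r t _ (≤-trans (≤-reflexive (ℕ.m+[n∸m]≡n le))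
        (≤-trans (ham-triangle (f u) (f (at t)) (f v)) (ℕ.+-monoʳ-≤ _ (after r t (ℕ.m+[n∸m]≡n le))))))
      where r = ham (f u) (f v) ∸ t

    at-between : ∀ t → t ≤ ham (f u) (f v) → Between (f u) (f (at t)) (f v)
    at-between t le = ham-between (f u) (f (at t)) (f v)
      (≤-trans (ℕ.+-mono-≤ (before t le) (after _ t (ℕ.m+[n∸m]≡n le))) (≤-reflexive (ℕ.m+[n∸m]≡n le)))

  geodesic : ∀ u v → Geodesic u v
  geodesic u v = record
    { at = λ t → proj₁ (go _ u refl) t ; at-0 = proj₁ (proj₂ (go _ u refl))
    ; at-end = proj₁ (proj₂ (proj₂ (go _ u refl))) ; step = proj₂ (proj₂ (proj₂ (go _ u refl))) }
    where
    cons : Fin n → (ℕ → Fin n) → ℕ → Fin n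
    cons u P zero = u
    cons u P (suc t) = P t
    go : ∀ h u → ham (f u) (f v) ≡ h →
      Σ (ℕ → Fin n) λ P → P 0 ≡ u × P h ≡ v × (∀ t → t < h → Adj G (P t) (P (suc t)))
    go zero u e = (λ _ → u) , refl , embedding-injective (ham-0 (f u) (f v) e) , λ _ ()
    go (suc h) u e with isometric (f u) (f v) (u , refl) (v , refl)
              (λ eq → ℕ.1+n≢0 (trans (sym e) (trans (cong (ham (f u)) (sym eq)) (ham-refl (f u)))))
    ... | i , ne , (u′ , eq) with go h u′ (suc-injective
              (trans (cong (λ x → suc (ham x (f v))) eq) (trans (ham-toward (f u) (f v) i ne) e)))
    ... | P , P0 , Ph , step = cons u P , refl , Ph , λ
      { zero _ → subst (Adj G u) (sym P0) (⇒adj eq)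
      ; (suc t) (s≤s lt) → step t lt }

-- Intervals between two edges of the same class

ham-⊹⊹ : ∀ {D} (x y : Vec Bool D) i → ham (x ⊹ i) (y ⊹ i) ≡ ham x y
ham-⊹⊹ x y i = cong ∣_∣ (trans (⊕-⊹ x (y ⊹ i) i) (trans
          (cong (_⊹ i) (trans (⊕-comm x (y ⊹ i)) (trans (⊕-⊹ y x i) (cong (_⊹ i) (⊕-comm y x)))))
  (⊹-inv (x ⊕ y) i)))

between-≤ : ∀ {D} (x z y : Vec Bool D) → Between x z y → ham x z ≤ ham x y
between-≤ x z y btw = ⊆-∣∣ (x ⊕ z) (x ⊕ y) λ i h → ≢⇒⊕ x y (λ e → ⊕-true x z h (sym (btw i e)))

between-< : ∀ {D} (x z y : Vec Bool D) → Between x z y → z ≢ y → ham x z < ham x y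
between-< x z y btw z≢y = ℕ.≤∧≢⇒< (between-≤ x z y btw) λ e → z≢y (‼-ext λ i → same e i)
  where
  same : ham x z ≡ ham x y → ∀ i → z ‼ i ≡ y ‼ i
  same e i = ⊕-false z y (trans (cong (_‼ i) zy) (≡⇒⊕ y y refl))
    where
    xz : x ⊕ z ≡ x ⊕ y
    xz = ⊆-∣∣-≡ (x ⊕ z) (x ⊕ y) (λ i h → ≢⇒⊕ x y (λ e → ⊕-true x z h (sym (btw i e)))) e
    zy : z ⊕ y ≡ y ⊕ y
    zy = cong (_⊕ y) (⊕-cancelˡ x z y xz)

-- The left side is the length of the cycle built in `Gap` when the two edges are at distance `m`.
half-of-4 : ∀ m → suc (m + suc m) ≡ 6 → m ≡ 2
half-of-4 2 e = refl
half-of-4 (suc (suc (suc m))) e with trans (ℕ.+-comm (4 + m) m)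
          (suc-injective (suc-injective (suc-injective (suc-injective e))))
... | ()

module Convexity (G : Graph) {d} (f : Fin (Graph.n G) → Vec Bool d)
                 (dist : ∀ u v → Dist G u v (hamming G (f u) (f v))) where
  open Graph G
  open PartialCubes G f dist
  open Induced induced using (adj⇒; ⇒adj)
  open Geodesic

  S : Vec Bool d → Set
  S = Image f

  -- Two edges u₀z₀ and x₀y₀ of class δ with no edge of this class between them.  The interval from u₀ to y₀
  -- then has a single vertex at each distance from u₀ on the side of u₀, and from y₀ on the other side.
  module Gap (noSquare : ¬ Cycle G 4) (δ : Fin d) (u₀ x₀ y₀ z₀ : Fin n) (fy : f y₀ ≡ f x₀ ⊹ δ) (fz : f z₀ ≡ f u₀ ⊹ δ)
             (same-side : f u₀ ‼ δ ≡ f x₀ ‼ δ) (u₀≢x₀ : u₀ ≢ x₀)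
             (gap : ∀ s → S s → S (s ⊹ δ) → s ‼ δ ≡ f u₀ ‼ δ → Between (f u₀) s (f x₀) → s ≡ f u₀ ⊎ s ≡ f x₀) where

    w x y z : Vec Bool d
    w = f u₀
    x = f x₀
    y = f y₀
    z = f z₀

    len : ℕ
    len = ham w x

    yδ : y ‼ δ ≡ not (w ‼ δ)
    yδ = trans (cong (_‼ δ) fy) (trans (⊹-at x δ) (cong not (sym same-side)))

    zδ : z ‼ δ ≡ not (w ‼ δ)
    zδ = trans (cong (_‼ δ) fz) (⊹-at w δ)

    y-off : ∀ {j} → j ≢ δ → y ‼ j ≡ x ‼ j
    y-off j≢δ = trans (cong (_‼ _) fy) (⊹-off x j≢δ)

    z-off : ∀ {j} → j ≢ δ → z ‼ j ≡ w ‼ j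
    z-off j≢δ = trans (cong (_‼ _) fz) (⊹-off w j≢δ)

    w≢y : w ‼ δ ≢ y ‼ δ
    w≢y e = not-≢ (sym (trans e yδ))

    len′ : ham y z ≡ len
    len′ = trans (cong₂ ham fy fz) (trans (ham-⊹⊹ x w δ) (ham-sym x w))

    Inside : Vec Bool d → Set
    Inside p = Between w p y

    inside-first : ∀ p → Inside p → p ‼ δ ≡ w ‼ δ → Between w p x
    inside-first p ins pδ j wx with j ≟ δ
    ... | yes refl = pδ
    ... | no j≢δ = ins j (trans wx (sym (y-off j≢δ)))

    inside-second : ∀ p → Inside p → p ‼ δ ≡ y ‼ δ → Between y p z
    inside-second p ins pδ j yz with j ≟ δ
    ... | yes refl = pδ
    ... | no j≢δ = trans (ins j wy) wy
      where wy : w ‼ j ≡ y ‼ j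
            wy = sym (trans yz (z-off j≢δ))

    first-inside : ∀ p → Between w p x → Inside p
    first-inside p btw j wy with j ≟ δ
    ... | yes refl = ⊥-elim (w≢y wy)
    ... | no j≢δ = btw j (trans wy (y-off j≢δ))

    second-inside : ∀ p → Between y p z → Inside p
    second-inside p btw j wy with j ≟ δ
    ... | yes refl = ⊥-elim (w≢y wy)
    ... | no j≢δ = trans (btw j (trans (sym wy) (sym (z-off j≢δ)))) (sym wy)

    -- A geodesic from p to q crosses the class δ at one of the two given edges.
    match : ∀ p q → S p → S q → Inside p → Inside q → p ‼ δ ≡ w ‼ δ → q ‼ δ ≡ y ‼ δ → ham w p ≡ ham y q →
      w ⊕ p ≡ y ⊕ q
    match p q Sp Sq ip iq pδ qδ size with Isometric.crossing {S = S} isometric (no-squares noSquare) δ p q Sp Sq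
              (λ e → w≢y (trans (sym pδ) (trans e qδ)))
    ... | s , Ss , Ssδ , sδ , btw with gap s Ss Ssδ (trans sδ pδ) between
      where
      between : Between w s x
      between j wx with j ≟ δ
      ... | yes refl = trans sδ pδ
      ... | no j≢δ = trans (btw j (trans (ip j wy) (sym (iq j wy)))) (ip j wy)
        where wy : w ‼ j ≡ y ‼ j
              wy = trans wx (sym (y-off j≢δ))
    -- If the geodesic passes `w`, a coordinate in which `p` differs from `w` is flipped before `w`
    -- and not again, so `q` differs from `y` in it. This inclusion and the equal sizes suffice;
    -- passing `x` is the mirror case.
    ... | inj₁ refl = ⊆-∣∣-≡ (w ⊕ p) (y ⊕ q) sub size
      where
      sub : ∀ j → (w ⊕ p) ‼ j ≡ true → (y ⊕ q) ‼ j ≡ true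
      sub j h = ≢⇒⊕ y q λ yq → ⊕-true w p h
        (sym (ip j (≢-≢⇒≡ (⊕-true w p h) (λ py → ⊕-true w p h (btw j (trans py yq))))))
    ... | inj₂ refl = sym (⊆-∣∣-≡ (y ⊕ q) (w ⊕ p) sub (sym size))
      where
      sub : ∀ j → (y ⊕ q) ‼ j ≡ true → (w ⊕ p) ‼ j ≡ true
      sub j h = ≢⇒⊕ w p λ wp → conflict wp
        where
        yq : y ‼ j ≢ q ‼ j
        yq = ⊕-true y q h
        conflict : w ‼ j ≡ p ‼ j → ⊥
        conflict wp = wy (trans wp (trans (sym (btw j pq)) (sym (y-off j≢δ))))
          where
          j≢δ : j ≢ δ
          j≢δ refl = yq (sym qδ)
          wy : w ‼ j ≢ y ‼ j
          wy e = yq (sym (trans (iq j e) e))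
          pq : p ‼ j ≡ q ‼ j
          pq = trans (sym wp) (≢-≢⇒≡ wy yq)

    P : Geodesic u₀ x₀
    P = geodesic u₀ x₀

    Q : Geodesic y₀ z₀
    Q = geodesic y₀ z₀

    Q≤ : ∀ {t} → t ≤ len → t ≤ ham y z
    Q≤ le = ≤-trans le (≤-reflexive (sym len′))

    P-ham : ∀ t → t ≤ len → ham w (f (at P t)) ≡ t
    P-ham = ham-at P

    Q-ham : ∀ t → t ≤ len → ham y (f (at Q t)) ≡ t
    Q-ham t le = ham-at Q t (Q≤ le)

    P-side : ∀ t → t ≤ len → f (at P t) ‼ δ ≡ w ‼ δ
    P-side t le = at-between P t le δ same-side

    Q-side : ∀ t → t ≤ len → f (at Q t) ‼ δ ≡ y ‼ δ
    Q-side t le = at-between Q t (Q≤ le) δ (trans yδ (sym zδ))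

    P-inside : ∀ t → t ≤ len → Inside (f (at P t))
    P-inside t le = first-inside (f (at P t)) (at-between P t le)

    Q-inside : ∀ t → t ≤ len → Inside (f (at Q t))
    Q-inside t le = second-inside (f (at Q t)) (at-between Q t (Q≤ le))

    P-match : ∀ q → S q → Inside q → q ‼ δ ≡ y ‼ δ → ∀ t → t ≤ len → ham y q ≡ t → w ⊕ f (at P t) ≡ y ⊕ q
    P-match q Sq iq qδ t le e = match _ q (_ , refl) Sq (P-inside t le) iq (P-side t le) qδ (trans (P-ham t le) (sym e))

    Q-match : ∀ p → S p → Inside p → p ‼ δ ≡ w ‼ δ → ∀ t → t ≤ len → ham w p ≡ t → w ⊕ p ≡ y ⊕ f (at Q t)
    Q-match p Sp ip pδ t le e = match p _ Sp (_ , refl) ip (Q-inside t le) pδ (Q-side t le) (trans e (sym (Q-ham t le)))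

    -- By `match`, both `f a` and the vertex of `P` at the same distance from `w` are antipodal to
    -- the same vertex of `Q`, hence equal.
    on-P : ∀ a → Inside (f a) → f a ‼ δ ≡ w ‼ δ → ham w (f a) ≤ len × at P (ham w (f a)) ≡ a
    on-P a ins side = le , embedding-injective (⊕-cancelˡ w _ _
        (trans (P-match _ (_ , refl) (Q-inside t le) (Q-side t le) t le (Q-ham t le))
               (sym (Q-match (f a) (a , refl) ins side t le refl))))
      where
      t = ham w (f a)
      le : t ≤ len
      le = between-≤ w (f a) x (inside-first (f a) ins side)

    on-Q : ∀ a → Inside (f a) → f a ‼ δ ≡ y ‼ δ → ham y (f a) ≤ len × at Q (ham y (f a)) ≡ a
    on-Q a ins side = le , embedding-injective (⊕-cancelˡ y _ _
        (trans (sym (Q-match _ (_ , refl) (P-inside t le) (P-side t le) t le (P-ham t le)))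
               (P-match (f a) (a , refl) ins side t le refl)))
      where
      t = ham y (f a)
      le : t ≤ len
      le = ≤-trans (between-≤ y (f a) z (inside-second (f a) ins side)) (≤-reflexive len′)

    -- `P` fills the positions 0 to `len` and `Q` those from `suc len` to `last`. The edge from `x₀`
    -- to `y₀` is the step at `len`, and the edge from `z₀` to `u₀` closes the cycle.
    vertex : ℕ → Fin n
    vertex t with t ℕ.≤? len
    ... | yes _ = at P t
    ... | no _ = at Q (t ∸ suc len)

    vertex-P : ∀ t → t ≤ len → vertex t ≡ at P t
    vertex-P t le with t ℕ.≤? len
    ... | yes _ = refl
    ... | no h = ⊥-elim (h le)

    vertex-Q : ∀ t → vertex (suc len + t) ≡ at Q t
    vertex-Q t with (suc len + t) ℕ.≤? len
    ... | yes le = ⊥-elim (ℕ.1+n≰n (≤-trans (ℕ.m≤m+n (suc len) t) le))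
    ... | no _ = cong (at Q) (ℕ.m+n∸m≡n (suc len) t)

    last : ℕ
    last = len + suc len

    data Position : ℕ → Set where
      on-first  : ∀ {t} → t ≤ len → Position t
      on-second : ∀ {t} → t ≤ len → Position (suc len + t)

    position : ∀ t → t ≤ last → Position t
    position t le with t ℕ.≤? len
    ... | yes h = on-first h
    ... | no h = subst Position (ℕ.m+[n∸m]≡n (ℕ.≰⇒> h)) (on-second
            (≤-trans (ℕ.∸-monoˡ-≤ (suc len) le) (≤-reflexive (ℕ.m+n∸n≡m len (suc len)))))

    sides-differ : ∀ {s t} → s ≤ len → t ≤ len → at P s ≢ at Q t
    sides-differ {s} {t} s≤ t≤ e = w≢y (trans (sym (P-side s s≤)) (trans (cong (λ a → f a ‼ δ) e) (Q-side t t≤)))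

    vertex-injective : ∀ s t → s ≤ last → t ≤ last → vertex s ≡ vertex t → s ≡ t
    vertex-injective s t s≤ t≤ e with position s s≤ | position t t≤
    ... | on-first {s} p | on-first {t} q = trans (sym (P-ham s p)) (trans (cong (ham w ∘ f)
            (trans (sym (vertex-P s p)) (trans e (vertex-P t q)))) (P-ham t q))
    ... | on-first {s} p | on-second {t} q = ⊥-elim (sides-differ p q
              (trans (sym (vertex-P s p)) (trans e (vertex-Q t))))
    ... | on-second {s} p | on-first {t} q = ⊥-elim (sides-differ q p
              (trans (sym (vertex-P t q)) (trans (sym e) (vertex-Q s))))
    ... | on-second {s} p | on-second {t} q = cong (suc len +_) (trans (sym (Q-ham s p)) (trans (cong (ham y ∘ f)
            (trans (sym (vertex-Q s)) (trans e (vertex-Q t)))) (Q-ham t q)))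

    start-P : vertex 0 ≡ u₀
    start-P = trans (vertex-P 0 z≤n) (at-0 P)

    end-P : vertex len ≡ x₀
    end-P = trans (vertex-P len ≤-refl) (at-end P)

    start-Q : vertex (suc len) ≡ y₀
    start-Q = trans (cong vertex (sym (ℕ.+-identityʳ (suc len)))) (trans (vertex-Q 0) (at-0 Q))

    end-Q : vertex last ≡ z₀
    end-Q = trans (cong vertex (+-suc len len)) (trans (vertex-Q len) (trans (cong (at Q) (sym len′)) (at-end Q)))

    vertex-step : ∀ t → t < last → Adj G (vertex t) (vertex (suc t))
    vertex-step t lt with position t (ℕ.<⇒≤ lt)
    ... | on-second {t} q = subst₂ (Adj G) (sym (vertex-Q t))
              (sym (trans (cong vertex (sym (+-suc (suc len) t))) (vertex-Q (suc t))))
            (step Q t (Q≤ (ℕ.+-cancelˡ-≤ (suc len) (suc t) len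
                      (≤-trans (≤-reflexive (+-suc (suc len) t)) (≤-trans lt (≤-reflexive (+-suc len len)))))))
    ... | on-first p with t ℕ.≟ len
    ... | yes refl = subst₂ (Adj G) (sym end-P) (sym start-Q) (⇒adj fy)
    ... | no t≢len = subst₂ (Adj G) (sym (vertex-P t p)) (sym (vertex-P (suc t) t<len)) (step P t t<len)
      where t<len : t < len
            t<len = ℕ.≤∧≢⇒< p t≢len

    len≥1 : 1 ≤ len
    len≥1 with len in e
    ... | zero = ⊥-elim (u₀≢x₀ (embedding-injective (ham-0 w x e)))
    ... | suc _ = s≤s z≤n

    cycle : Cycle G (suc last)
    cycle = make-cycle G vertex (ℕ.+-mono-≤ len≥1 (s≤s z≤n)) vertex-injective vertex-step
      (subst₂ (Adj G) (sym end-Q) (sym start-P) (adj-comm G (⇒adj fz)))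

    index : ∀ t → t ≤ last → Σ (Fin (suc last)) λ i → toℕ i ≡ t
    index t le = fromℕ< (s≤s le) , toℕ-fromℕ< (s≤s le)

    on-cycle : ∀ t → t ≤ last → ∀ {a} → vertex t ≡ a → OnCycle G cycle a
    on-cycle t le e with index t le
    ... | i , refl = i , e

    edge-along : ∀ t → t < last → ∀ {a b} → vertex t ≡ a → vertex (suc t) ≡ b → CycleEdge G cycle a b
    edge-along t lt ea eb with index t (ℕ.<⇒≤ lt) | index (suc t) lt
    ... | i , refl | j , e = i , j , inj₁ (sym e) , inj₁ (ea , trans (cong vertex e) eb)

    edge-closing : ∀ {a b} → vertex last ≡ a → vertex 0 ≡ b → CycleEdge G cycle a b
    edge-closing ea eb with index last ≤-refl | index 0 z≤n
    ... | i , e | j , e′ = i , j , inj₂ (cong suc e , e′) , inj₁ (trans (cong vertex e) ea , trans (cong vertex e′) eb)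

    edge-sym : ∀ {a b} → CycleEdge G cycle a b → CycleEdge G cycle b a
    edge-sym (i , j , con , inj₁ (p , q)) = i , j , con , inj₂ (p , q)
    edge-sym (i , j , con , inj₂ (p , q)) = i , j , con , inj₁ (p , q)

    second≤last : ∀ {t} → t ≤ len → suc len + t ≤ last
    second≤last le = ≤-trans (ℕ.+-monoʳ-≤ (suc len) le) (≤-reflexive (sym (+-suc len len)))

    side : ∀ a → f a ‼ δ ≡ w ‼ δ ⊎ f a ‼ δ ≡ y ‼ δ
    side a with f a ‼ δ ≟ᵇ w ‼ δ
    ... | yes e = inj₁ e
    ... | no ne = inj₂ (≢-≢⇒≡ ne w≢y)

    inside-on-cycle : ∀ a → Inside (f a) → OnCycle G cycle a
    inside-on-cycle a ins with side a
    ... | inj₁ e = let le , eq = on-P a ins e in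
            on-cycle _ (≤-trans le (ℕ.m≤m+n len _)) (trans (vertex-P _ le) eq)
    ... | inj₂ e = let le , eq = on-Q a ins e in
            on-cycle _ (second≤last le) (trans (vertex-Q _) eq)

    on-cycle-inside : ∀ a → OnCycle G cycle a → Inside (f a)
    on-cycle-inside a (i , refl) with toℕ i | position (toℕ i) (ℕ.≤-pred (toℕ<n i))
    ... | t | on-first p = subst (Inside ∘ f) (sym (vertex-P t p)) (P-inside t p)
    ... | _ | on-second {t} p = subst (Inside ∘ f) (sym (vertex-Q t)) (Q-inside t p)

    edge-first : ∀ {a b} → Inside (f a) → Inside (f b) → f a ‼ δ ≡ w ‼ δ → f b ‼ δ ≡ w ‼ δ →
      ham w (f b) ≡ suc (ham w (f a)) → CycleEdge G cycle a b
    edge-first {a} {b} ia ib sa sb e =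
      let le , eq = on-P a ia sa
          le′ , eq′ = on-P b ib sb
      in edge-along (ham w (f a)) (≤-trans (≤-trans (≤-reflexive (sym e)) le′) (ℕ.m≤m+n len _))
           (trans (vertex-P _ le) eq)
           (trans (cong vertex (sym e)) (trans (vertex-P _ le′) eq′))

    edge-second : ∀ {a b} → Inside (f a) → Inside (f b) → f a ‼ δ ≡ y ‼ δ → f b ‼ δ ≡ y ‼ δ →
      ham y (f b) ≡ suc (ham y (f a)) → CycleEdge G cycle a b
    edge-second {a} {b} ia ib sa sb e =
      let le , eq = on-Q a ia sa
          le′ , eq′ = on-Q b ib sb
      in edge-along (suc len + ham y (f a))
           (≤-trans (≤-reflexive (trans (sym (+-suc (suc len) _)) (cong (suc len +_) (sym e)))) (second≤last le′))
           (trans (vertex-Q _) eq)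
           (trans (cong vertex (trans (sym (+-suc (suc len) _)) (cong (suc len +_) (sym e)))) (trans (vertex-Q _) eq′))

    -- By `gap`, an edge of class `δ` within the interval is one of the two given ones, and both
    -- were built into the cycle.
    edge-across : ∀ {a b} → Adj G a b → Inside (f a) → f a ‼ δ ≡ w ‼ δ → f b ‼ δ ≡ y ‼ δ → CycleEdge G cycle a b
    edge-across {a} {b} ab ia sa sb with adj⇒ ab
    ... | i , e with δ ≟ i
    ... | no δ≢i = ⊥-elim (w≢y (trans (sym sa) (trans (sym (trans (cong (_‼ δ) e) (⊹-off (f a) δ≢i))) sb)))
    ... | yes refl with gap (f a) (a , refl) (b , e) sa (inside-first (f a) ia sa)
    ... | inj₁ a≡w = edge-sym (edge-closing (trans end-Q
              (embedding-injective (trans fz (trans (cong (_⊹ δ) (sym a≡w)) (sym e)))))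
                                 (trans start-P (embedding-injective (sym a≡w))))
    ... | inj₂ a≡x = edge-along len (ℕ.m<m+n len (s≤s z≤n)) (trans end-P (embedding-injective (sym a≡x)))
                       (trans start-Q (embedding-injective (trans fy (trans (cong (_⊹ δ) (sym a≡x)) (sym e)))))

    ham-adjacent : ∀ {a b} (p : Vec Bool d) → Adj G a b → ham p (f b) ≡ suc (ham p (f a)) ⊎ ham p (f a) ≡ suc
              (ham p (f b))
    ham-adjacent {a} {b} p ab with adj⇒ ab
    ... | i , e rewrite e with f a ‼ i ≟ᵇ p ‼ i
    ... | yes same = inj₁ (trans (ham-sym p _) (trans (ham-away (f a) p i same) (cong suc (ham-sym (f a) p))))
    ... | no ne = inj₂ (trans (ham-sym p _) (trans (sym (ham-toward (f a) p i ne)) (cong suc (ham-sym (f a ⊹ i) p))))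

    inside-edge : ∀ {a b} → Adj G a b → Inside (f a) → Inside (f b) → CycleEdge G cycle a b
    inside-edge {a} {b} ab ia ib with side a | side b
    ... | inj₁ sa | inj₂ sb = edge-across ab ia sa sb
    ... | inj₂ sa | inj₁ sb = edge-sym (edge-across (adj-comm G ab) ib sb sa)
    ... | inj₁ sa | inj₁ sb = [ edge-first ia ib sa sb , edge-sym ∘ edge-first ib ia sb sa ]′ (ham-adjacent w ab)
    ... | inj₂ sa | inj₂ sb = [ edge-second ia ib sa sb , edge-sym ∘ edge-second ib ia sb sa ]′ (ham-adjacent y ab)

    -- The interval is closed under geodesics, since these keep the coordinates in which their ends
    -- agree; its vertices and edges are those of the cycle.
    cycle-convex : ConvexCycle G cycle
    cycle-convex u v on-u on-v m walk shortest =
      (λ i → inside-on-cycle _ (inside i)) ,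
      (λ i → inside-edge (Walk.step walk i) (inside (inject₁ i)) (inside (suc i)))
      where
      inside : ∀ i → Inside (f (Walk.p walk i))
      inside i j wy = trans (shortest-between walk shortest i j
          (trans (on-cycle-inside u on-u j wy) (sym (on-cycle-inside v on-v j wy)))) (on-cycle-inside u on-u j wy)

  module _ (noSquare : ¬ Cycle G 4) (convex6 : AllConvexCycles6 G) where

    no4 : NoSquares S
    no4 = no-squares noSquare

    open Isometric {S = S} isometric no4

    Inner : Fin d → Vec Bool d → Vec Bool d → Fin n → Set
    Inner δ w x u = S (f u ⊹ δ) × f u ‼ δ ≡ w ‼ δ × Between w (f u) x × f u ≢ w × f u ≢ x

    inner? : ∀ δ w x u → Dec (Inner δ w x u)
    inner? δ w x u = image? f (f u ⊹ δ) ×-dec (f u ‼ δ ≟ᵇ w ‼ δ ×-dec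
      (all? (λ j → (w ‼ j ≟ᵇ x ‼ j) →-dec (f u ‼ j ≟ᵇ w ‼ j)) ×-dec
        (¬? (≡-dec _≟ᵇ_ (f u) w) ×-dec ¬? (≡-dec _≟ᵇ_ (f u) x))))

    -- At distance two the hexagon is forced: the midpoint on the side of `w` is `w ⊹ m`, and the
    -- one on the other side must be `w ⊹ δ ⊹ l`, since `w ⊹ δ ⊹ m` would close a square.
    narrow : ∀ δ w x → S w → S (w ⊹ δ) → S x → S (x ⊹ δ) → w ‼ δ ≡ x ‼ δ → ham w x ≡ 2 →
      ∃[ m ] ∃[ l ] Hexagon S w δ m l × w ‼ m ≢ x ‼ m × w ‼ l ≢ x ‼ l
    narrow δ w x Sw Swδ Sx Sxδ same size
      with isometric w x Sw Sx (λ { refl → ℕ.1+n≢0 (trans (sym size) (ham-refl w)) })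
    ... | m , wm≢xm , Swm with ham-1 (w ⊹ m) x (suc-injective (trans (ham-toward w x m wm≢xm) size))
    ... | l , refl = m , l , hexagon , wm≢xm , wl≢xl
      where
      m≢l : m ≢ l
      m≢l refl = wm≢xm (sym (cong (_‼ m) (⊹-inv w m)))
      m≢δ : m ≢ δ
      m≢δ refl = wm≢xm same
      wl≢xl : w ‼ l ≢ (w ⊹ m ⊹ l) ‼ l
      wl≢xl e = not-≢ (trans (sym (trans (⊹-at (w ⊹ m) l) (cong not (⊹-off w (≢-sym m≢l))))) (sym e))
      l≢δ : l ≢ δ
      l≢δ refl = wl≢xl same
      Swδlm : S (w ⊹ δ ⊹ l ⊹ m)
      Swδlm = subst S (⊹-rev w m l δ) Sxδ
      hexagon : Hexagon S w δ m l
      hexagon = record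
        { m≢l = m≢l ; m≢d = m≢δ ; l≢d = l≢δ ; w+m = Swm ; w+ml = Sx
        ; w+dl = [ id , (λ Swδm → ⊥-elim (no4 w δ m (≢-sym m≢δ) Sw Swδ Swm Swδm)) ]′
                   (two-step (w ⊹ δ) l m (≢-sym m≢l) Swδ Swδlm)
        ; w+dlm = Swδlm }

    -- An edge of the class strictly in between takes the place of the one at `x`, as what separates
    -- `w` from it also separates `w` from `x`. With none in between, the interval is a convex
    -- cycle, so it has six vertices and the distance is two.
    zones-below : ∀ b δ w x → ham w x < b → S w → S (w ⊹ δ) → S x → S (x ⊹ δ) → w ‼ δ ≡ x ‼ δ → w ≢ x →
      ∃[ m ] ∃[ l ] Hexagon S w δ m l × w ‼ m ≢ x ‼ m × w ‼ l ≢ x ‼ l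
    zones-below (suc b) δ w x (s≤s le) Sw Swδ Sx Sxδ same w≢x with any? (inner? δ w x)
    ... | yes (u , Suδ , uδ , btw , u≢w , u≢x) =
      let m , l , hex , ne , ne′ = zones-below b δ w (f u) (≤-trans (between-< w (f u) x btw u≢x) le)
                                     Sw Swδ (u , refl) Suδ (sym uδ) (≢-sym u≢w)
      in m , l , hex , (λ e → ne (sym (btw m e))) , (λ e → ne′ (sym (btw l e)))
    zones-below (suc b) δ _ _ (s≤s le) (u₀ , refl) (z₀ , fz) (x₀ , refl) (y₀ , fy) same w≢x | no ¬inner =
      narrow δ (f u₀) (f x₀) (u₀ , refl) (z₀ , fz) (x₀ , refl) (y₀ , fy) same
        (half-of-4 _ (convex6 _ cycle cycle-convex))
      where
      gap : ∀ s → S s → S (s ⊹ δ) → s ‼ δ ≡ f u₀ ‼ δ → Between (f u₀) s (f x₀) → s ≡ f u₀ ⊎ s ≡ f x₀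
      gap _ (u , refl) Ssδ sδ btw with ≡-dec _≟ᵇ_ (f u) (f u₀) | ≡-dec _≟ᵇ_ (f u) (f x₀)
      ... | yes e | _ = inj₁ e
      ... | no _ | yes e = inj₂ e
      ... | no u≢w | no u≢x = ⊥-elim (¬inner (u , Ssδ , sδ , btw , u≢w , u≢x))
      u₀≢x₀ : u₀ ≢ x₀
      u₀≢x₀ refl = w≢x refl
      open Gap noSquare δ u₀ x₀ y₀ z₀ fy fz same u₀≢x₀ gap using (cycle; cycle-convex)

    zones : Zones S
    zones δ w x = zones-below _ δ w x ≤-refl

-- Convex cycles when all paths of length three close up

module ClosedConvex (G : Graph) {d} (f : Fin (Graph.n G) → Vec Bool d)
                    (dist : ∀ u v → Dist G u v (hamming G (f u) (f v))) where
  open Graph G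
  open PartialCubes G f dist
  open Induced induced using (inj; adj⇒; ⇒adj)

  cycle-edge-indices : ∀ {ℓ} (C : Cycle G ℓ) {x y} s t → Cycle.c C s ≡ x → Cycle.c C t ≡ y → CycleEdge G C x y →
    Consecutive G s t ⊎ Consecutive G t s
  cycle-edge-indices C s t es et (s′ , t′ , con , inj₁ (p , q))
    rewrite Cycle.inj C (trans es (sym p)) | Cycle.inj C (trans et (sym q)) = inj₁ con
  cycle-edge-indices C s t es et (s′ , t′ , con , inj₂ (p , q))
    rewrite Cycle.inj C (trans es (sym q)) | Cycle.inj C (trans et (sym p)) = inj₂ con

  module _ {m} (C : Cycle G (6 + m)) where
    open Cycle C renaming (inj to c-inj)

    before-0 : ∀ s → s ≢ 1F → Consecutive G 0F s ⊎ Consecutive G s 0F → toℕ s ≡ 5 + m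
    before-0 s s≢1 (inj₁ (inj₁ e)) = ⊥-elim (s≢1 (toℕ-injective (sym e)))
    before-0 s s≢1 (inj₂ (inj₂ (e , _))) = suc-injective e

    before-last : ∀ s t → s ≢ 0F → toℕ t ≡ 5 + m → Consecutive G t s ⊎ Consecutive G s t → toℕ s ≡ 4 + m
    before-last s t s≢0 e (inj₁ (inj₁ e′)) = ⊥-elim (ℕ.<-irrefl (trans (sym e′) (cong suc e)) (toℕ<n s))
    before-last s t s≢0 e (inj₁ (inj₂ (_ , e′))) = ⊥-elim (s≢0 (toℕ-injective e′))
    before-last s t s≢0 e (inj₂ (inj₁ e′)) = suc-injective (trans e′ e)
    before-last s t s≢0 e (inj₂ (inj₂ (_ , e′))) with trans (sym e) e′
    ... | ()

    length-6 : ∀ (s : Fin (6 + m)) → toℕ s ≡ 4 + m → Consecutive G s 3F ⊎ Consecutive G 3F s → 6 + m ≡ 6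
    length-6 s e (inj₁ (inj₁ e′)) with trans (cong suc (sym e)) e′
    ... | ()
    length-6 s e (inj₂ (inj₂ (() , _)))
    length-6 s e (inj₂ (inj₁ e′)) = cong (2 +_) (sym (trans e′ e))

    -- The second geodesic from `c 0F` to `c 3F`, with directions `l`, `j`, `i`, lies on the convex
    -- cycle. It leaves `c 0F` backwards, so the remaining arc has only three edges.
    closed⇒length-6 : PathsClose (Image f) → ConvexCycle G C → 6 + m ≡ 6
    closed⇒length-6 close convex with adj⇒ (edges 0F 1F (inj₁ refl)) | adj⇒ (edges 1F 2F (inj₁ refl)) | adj⇒
              (edges 2F 3F (inj₁ refl))
    ... | i , e₁ | j , e₂ | l , e₃ = finish (close v i j l i≢j j≢l (_ , refl) (_ , e₁) (_ , e₂′) (_ , e₃′))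
      where
      v : Vec Bool d
      v = f (c 0F)
      e₂′ : f (c 2F) ≡ v ⊹ i ⊹ j
      e₂′ = trans e₂ (cong (_⊹ j) e₁)
      e₃′ : f (c 3F) ≡ v ⊹ i ⊹ j ⊹ l
      e₃′ = trans e₃ (cong (_⊹ l) e₂′)
      i≢j : i ≢ j
      i≢j refl = contradiction (c-inj (inj (trans e₂′ (⊹-inv v i)))) λ ()
      j≢l : j ≢ l
      j≢l refl = contradiction (c-inj (inj (trans e₃′ (trans (⊹-inv (v ⊹ i) j) (sym e₁))))) λ ()
      finish : i ≢ l × Image f (v ⊹ l) × Image f (v ⊹ l ⊹ j) → 6 + m ≡ 6
      finish (i≢l , (q , eq) , (r , er)) =
        let (on , along) = convex (c 0F) (c 3F) (_ , refl) (_ , refl) 3 walk is-shortest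
            s , es = on 1F
            t , et = on 2F
            s≡ = before-0 s (λ e → i≢l (⊹-dir v i l (trans (sym e₁) (trans (cong f (trans (cong c (sym e)) es)) eq))))
                   (cycle-edge-indices C 0F s refl es (along 0F))
            t≡ = before-last t s (λ e → a≢r (trans (cong c (sym e)) et)) s≡ (cycle-edge-indices C s t es et (along 1F))
        in length-6 t t≡ (cycle-edge-indices C t 3F et refl (along 2F))
        where
        a≢r : c 0F ≢ r
        a≢r e = not-≢ (trans (sym (trans (cong (_‼ l) er) (trans (⊹-off (v ⊹ l) (≢-sym j≢l)) (⊹-at v l))))
                  (cong ((_‼ l) ∘ f) (sym e)))
        walk : Walk G 3 (c 0F) (c 3F)
        walk = record { p = lookup (c 0F ∷ q ∷ r ∷ c 3F ∷ []) ; start = refl ; end = refl ; step = λ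
          { 0F → ⇒adj eq
          ; 1F → ⇒adj (trans er (cong (_⊹ j) (sym eq)))
          ; 2F → ⇒adj (trans e₃′ (trans (⊹-rot v i j l) (trans (⊹-swap₂ v j l i) (cong (_⊹ i) (sym er))))) } }
        is-shortest : Dist G (c 0F) (c 3F) 3
        is-shortest = subst (Dist G (c 0F) (c 3F)) (trans (cong (ham v) e₃′) (ham-triple v i≢j j≢l i≢l))
                  (ham-shortest _ _)

  closed⇒convex-6 : (∀ ℓ → ℓ < 6 → ¬ Cycle G ℓ) → PathsClose (Image f) → AllConvexCycles6 G
  closed⇒convex-6 girth close ℓ C convex with ℓ ℕ.<? 6
  ... | yes lt = ⊥-elim (girth ℓ lt C)
  ... | no ≮ with ℕ.m≤n⇒∃[o]m+o≡n (ℕ.≮⇒≥ ≮)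
  ... | m , refl = closed⇒length-6 C close convex

-- The two middle layers of a cube

Middle : ℕ → ∀ {m} → Subset m → Set
Middle k s = ∣ s ∣ ≡ k ∸ 1 ⊎ ∣ s ∣ ≡ k

Nested : ℕ → ∀ {m} → Subset m → Subset m → Set
Nested k s t = (∣ s ∣ ≡ k ∸ 1 × ∣ t ∣ ≡ k × s ⊆ t) ⊎ (∣ t ∣ ≡ k ∸ 1 × ∣ s ∣ ≡ k × t ⊆ s)

escape : ∀ {m} (p q : Subset m) → p ≢ q → ∣ q ∣ ≤ ∣ p ∣ → ∃[ i ] p ‼ i ≡ true × q ‼ i ≡ false
escape p q p≢q le with any? (λ i → (p ‼ i ≟ᵇ true) ×-dec (q ‼ i ≟ᵇ false))
... | yes h = h
... | no none = ⊥-elim (p≢q (⊆-∣∣-≡ p q sub (ℕ.≤-antisym (⊆-∣∣ p q sub) le)))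
  where
  sub : ∀ i → p ‼ i ≡ true → q ‼ i ≡ true
  sub i pi = ¬-not λ qi → none (i , pi , qi)

⊆⇒‼ : ∀ {m} {s t : Subset m} → s ⊆ t → ∀ i → s ‼ i ≡ true → t ‼ i ≡ true
⊆⇒‼ {s = s} {t} sub i e = []=⇒lookup (sub (lookup⇒[]= i s e))

‼⇒⊆ : ∀ {m} {s t : Subset m} → (∀ i → s ‼ i ≡ true → t ‼ i ≡ true) → s ⊆ t
‼⇒⊆ {t = t} sub {i} h = lookup⇒[]= i t (sub i ([]=⇒lookup h))

module Layers (k : ℕ) where

  size : Bool → ℕ
  size true  = suc k
  size false = k

  Middle⇒size : ∀ {m} {s : Subset m} → Middle (suc k) s → ∃[ β ] ∣ s ∣ ≡ size β
  Middle⇒size (inj₁ e) = false , e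
  Middle⇒size (inj₂ e) = true , e

  size⇒Middle : ∀ {m} {s : Subset m} β → ∣ s ∣ ≡ size β → Middle (suc k) s
  size⇒Middle true  e = inj₂ e
  size⇒Middle false e = inj₁ e

  flip-size : ∀ {m} (s : Subset m) i β → ∣ s ∣ ≡ size β → s ‼ i ≡ β → ∣ s ⊹ i ∣ ≡ size (not β)
  flip-size s i true  e h = suc-injective (trans (∣⊹∣-in s i h) e)
  flip-size s i false e h = trans (∣⊹∣-out s i h) (cong suc e)

  -- Flipping a coordinate of the other value would leave the two layers. So the directions at a
  -- vertex of layer `β` are the coordinates with value `β`.
  flip-bit : ∀ {m} (s : Subset m) i β → ∣ s ∣ ≡ size β → Middle (suc k) (s ⊹ i) → s ‼ i ≡ β
  flip-bit s i β e mid with s ‼ i in h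
  flip-bit s i true  e mid | true  = refl
  flip-bit s i false e mid | false = refl
  flip-bit s i true  e mid | false with trans (∣⊹∣-out s i h) (cong suc e) | mid
  ... | e′ | inj₁ e″ = ⊥-elim (ℕ.m≢1+n+m k {1} (trans (sym e″) e′))
  ... | e′ | inj₂ e″ = ⊥-elim (ℕ.1+n≢n (trans (sym e′) e″))
  flip-bit s i false e mid | true with trans (∣⊹∣-in s i h) e | mid
  ... | e′ | inj₁ e″ = ⊥-elim (ℕ.1+n≢n (trans (cong suc (sym e″)) e′))
  ... | e′ | inj₂ e″ = ⊥-elim (ℕ.m≢1+n+m k {1} (trans (sym e′) (cong suc e″)))

  -- Layers alternate along the path, so `v` has the values `β`, `not β`, `β` at `i`, `j`, `l`. The
  -- flips `l`, `j` are therefore as admissible as `i`, `j`.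
  middle-close : ∀ {m} → PathsClose (Middle (suc k) {m})
  middle-close v i j l i≢j j≢l Mv Mvi Mvij Mvijl with Middle⇒size {s = v} Mv
  ... | β , e = i≢l , size⇒Middle {s = v ⊹ l} (not β) vl-size ,
        size⇒Middle {s = v ⊹ l ⊹ j} (not (not β)) (flip-size (v ⊹ l) j (not β) vl-size (trans (⊹-off v j≢l) vj))
    where
    vi : v ‼ i ≡ β
    vi = flip-bit v i β e Mvi
    vi-size : ∣ v ⊹ i ∣ ≡ size (not β)
    vi-size = flip-size v i β e vi
    vij : (v ⊹ i) ‼ j ≡ not β
    vij = flip-bit (v ⊹ i) j (not β) vi-size Mvij
    vj : v ‼ j ≡ not β
    vj = trans (sym (⊹-off v (≢-sym i≢j))) vij
    vijl : (v ⊹ i ⊹ j) ‼ l ≡ β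
    vijl = trans (flip-bit (v ⊹ i ⊹ j) l (not (not β)) (flip-size (v ⊹ i) j (not β) vi-size vij) Mvijl)
              (not-involutive β)
    i≢l : i ≢ l
    i≢l refl = not-≢ (trans (cong not (sym vi)) (trans (sym (⊹-at v i)) (trans (sym (⊹-off (v ⊹ i) i≢j)) vijl)))
    vl : v ‼ l ≡ β
    vl = trans (sym (trans (⊹-off (v ⊹ i) (≢-sym j≢l)) (⊹-off v (≢-sym i≢l)))) vijl
    vl-size : ∣ v ⊹ l ∣ ≡ size (not β)
    vl-size = flip-size v l β e vl

  ⊆⇒flip : ∀ {m} {s t : Subset m} → ∣ s ∣ ≡ k → ∣ t ∣ ≡ suc k → s ⊆ t → ∃[ i ] t ≡ s ⊹ i
  ⊆⇒flip {s = s} {t} es et sub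
    with escape t s (λ { refl → ℕ.1+n≢n (trans (sym et) es) })
              (≤-trans (≤-reflexive es) (≤-trans (ℕ.n≤1+n k) (≤-reflexive (sym et))))
  ... | i , ti , si = i , sym (⊆-∣∣-≡ (s ⊹ i) t sub′ (trans (∣⊹∣-out s i si) (trans (cong suc es) (sym et))))
    where
    sub′ : ∀ j → (s ⊹ i) ‼ j ≡ true → t ‼ j ≡ true
    sub′ j h with j ≟ i
    ... | yes refl = ti
    ... | no j≢i = ⊆⇒‼ {s = s} sub j (trans (sym (⊹-off s j≢i)) h)

  nested⇒flip : ∀ {m} {s t : Subset m} → Nested (suc k) s t → ∃[ i ] t ≡ s ⊹ i
  nested⇒flip (inj₁ (es , et , sub)) = ⊆⇒flip es et sub
  nested⇒flip {s = s} {t} (inj₂ (et , es , sub)) =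
    let i , e = ⊆⇒flip et es sub in i , trans (sym (⊹-inv t i)) (cong (_⊹ i) (sym e))

  ⊆-⊹ : ∀ {m} (s : Subset m) i → s ‼ i ≡ false → s ⊆ s ⊹ i
  ⊆-⊹ s i si = ‼⇒⊆ {s = s} λ j h → trans (⊹-off s (λ { refl → not-≢ {true} (trans (sym si) h) })) h

  flip⇒nested : ∀ {m} (s : Subset m) i → Middle (suc k) s → Middle (suc k) (s ⊹ i) → Nested (suc k) s (s ⊹ i)
  flip⇒nested s i ms mi with Middle⇒size {s = s} ms
  ... | β , e with flip-bit s i β e mi | flip-size s i β e (flip-bit s i β e mi)
  flip⇒nested s i ms mi | false , e | si | e′ = inj₁ (e , e′ , ⊆-⊹ s i si)
  flip⇒nested s i ms mi | true , e | si | e′ =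
    inj₂ (e′ , e , subst ((s ⊹ i) ⊆_) (⊹-inv s i) (⊆-⊹ (s ⊹ i) i (trans (⊹-at s i) (cong not si))))

module _ (G : Graph) where
  open Graph G

  doubled-odd⇒P3InC6 : ∀ k → IsoDoubledOdd G (suc k) → P3InC6 G
  doubled-odd⇒P3InC6 k (φ , φ-inj , middle , onto , adj⇔) = Embedded.paths-close⇒P3InC6 G φ ind close
    where
    open Layers k
    ind : Induced G φ
    ind = record
      { inj = φ-inj
      ; adj⇒ = λ {u} {v} uv → nested⇒flip (proj₁ (adj⇔ u v) uv)
      ; ⇒adj = λ {u} {v} {i} e → proj₂ (adj⇔ u v)
          (subst (Nested (suc k) (φ u)) (sym e) (flip⇒nested (φ u) i (middle u)
                    (subst (Middle (suc k)) e (middle v)))) }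
    mid : ∀ {x} → Image φ x → Middle (suc k) x
    mid (u , refl) = middle u
    close : PathsClose (Image φ)
    close v i j l i≢j j≢l Sv Svi Svij Svijl =
      let i≢l , Mvl , Mvlj = middle-close v i j l i≢j j≢l (mid Sv) (mid Svi) (mid Svij) (mid Svijl)
      in i≢l , onto _ Mvl , onto _ Mvlj

-- Subsets of a fixed set of coordinates

∣∪∣-disjoint : ∀ {m} (p q : Subset m) → (∀ i → p ‼ i ≡ true → q ‼ i ≡ false) → ∣ p ∪ q ∣ ≡ ∣ p ∣ + ∣ q ∣
∣∪∣-disjoint [] [] dis = refl
∣∪∣-disjoint (true  ∷ p) (true  ∷ q) dis with dis 0F refl
... | ()
∣∪∣-disjoint (true  ∷ p) (false ∷ q) dis = cong suc (∣∪∣-disjoint p q (dis ∘ suc))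
∣∪∣-disjoint (false ∷ p) (true  ∷ q) dis = trans (cong suc (∣∪∣-disjoint p q (dis ∘ suc))) (sym (+-suc ∣ p ∣ ∣ q ∣))
∣∪∣-disjoint (false ∷ p) (false ∷ q) dis = ∣∪∣-disjoint p q (dis ∘ suc)

infix 4 _⊑_

_⊑_ : ∀ {m} → Subset m → Subset m → Set
p ⊑ q = ∀ i → p ‼ i ≡ true → q ‼ i ≡ true

restrict : ∀ {m} (Λ : Subset m) → Subset m → Subset ∣ Λ ∣
restrict [] [] = []
restrict (true  ∷ Λ) (b ∷ p) = b ∷ restrict Λ p
restrict (false ∷ Λ) (b ∷ p) = restrict Λ p

extend : ∀ {m} (Λ : Subset m) → Subset ∣ Λ ∣ → Subset m
extend [] [] = []
extend (true  ∷ Λ) (b ∷ p) = b ∷ extend Λ p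
extend (false ∷ Λ) p = false ∷ extend Λ p

restrict-extend : ∀ {m} (Λ : Subset m) p → restrict Λ (extend Λ p) ≡ p
restrict-extend [] [] = refl
restrict-extend (true  ∷ Λ) (b ∷ p) = cong (b ∷_) (restrict-extend Λ p)
restrict-extend (false ∷ Λ) p = restrict-extend Λ p

extend-⊑ : ∀ {m} (Λ : Subset m) p → extend Λ p ⊑ Λ
extend-⊑ (true  ∷ Λ) (b ∷ p) 0F e = refl
extend-⊑ (true  ∷ Λ) (b ∷ p) (suc i) e = extend-⊑ Λ p i e
extend-⊑ (false ∷ Λ) p (suc i) e = extend-⊑ Λ p i e

extend-restrict : ∀ {m} (Λ p : Subset m) → p ⊑ Λ → extend Λ (restrict Λ p) ≡ p
extend-restrict [] [] sub = refl
extend-restrict (true  ∷ Λ) (b ∷ p) sub = cong (b ∷_) (extend-restrict Λ p (sub ∘ suc))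
extend-restrict (false ∷ Λ) (false ∷ p) sub = cong (false ∷_) (extend-restrict Λ p (sub ∘ suc))
extend-restrict (false ∷ Λ) (true ∷ p) sub with sub 0F refl
... | ()

∣extend∣ : ∀ {m} (Λ : Subset m) p → ∣ extend Λ p ∣ ≡ ∣ p ∣
∣extend∣ [] [] = refl
∣extend∣ (true  ∷ Λ) (true  ∷ p) = cong suc (∣extend∣ Λ p)
∣extend∣ (true  ∷ Λ) (false ∷ p) = ∣extend∣ Λ p
∣extend∣ (false ∷ Λ) p = ∣extend∣ Λ p

extend-⊹ : ∀ {m} (Λ : Subset m) p t → ∃[ i ] extend Λ (p ⊹ t) ≡ extend Λ p ⊹ i
extend-⊹ (true  ∷ Λ) (b ∷ p) 0F = 0F , refl
extend-⊹ (true  ∷ Λ) (b ∷ p) (suc t) = let i , e = extend-⊹ Λ p t in suc i , cong (b ∷_) e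
extend-⊹ (false ∷ Λ) p t = let i , e = extend-⊹ Λ p t in suc i , cong (false ∷_) e

restrict-⊹ : ∀ {m} (Λ p : Subset m) i → Λ ‼ i ≡ true → ∃[ t ] restrict Λ (p ⊹ i) ≡ restrict Λ p ⊹ t
restrict-⊹ (true  ∷ Λ) (b ∷ p) 0F e = 0F , refl
restrict-⊹ (true  ∷ Λ) (b ∷ p) (suc i) e = let t , h = restrict-⊹ Λ p i e in suc t , cong (b ∷_) h
restrict-⊹ (false ∷ Λ) (b ∷ p) (suc i) e = restrict-⊹ Λ p i e

-- Translation onto the two middle layers

module Layered {n D} (f : Fin n → Vec Bool D) (iso : IsometricIn (Image f)) (no4 : NoSquares (Image f))
  (close : PathsClose (Image f)) (k : ℕ) (regular : ∀ x → Image f x → ∣ nb f x ∣ ≡ suc k)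
  (o : Vec Bool D) (So : Image f o) where

  open Layers k

  S : Vec Bool D → Set
  S = Image f

  neighbour : ∀ x → S x → ∃[ i ] S (x ⊹ i)
  neighbour x Sx = let i , h = ∣p∣≢0⇒∈ (nb f x) (regular x Sx) in i , nb-out f x h

  i₀ : Fin D
  i₀ = proj₁ (neighbour o So)

  Soi₀ : S (o ⊹ i₀)
  Soi₀ = proj₂ (neighbour o So)

  -- The path `x ⊹ i′`, `x`, `x ⊹ i`, `x ⊹ i ⊹ j` closes to a hexagon whose other half starts with
  -- `j`. So the directions leading on from a neighbour of `x` do not depend on the neighbour.
  transfer : ∀ x i i′ j → S x → S (x ⊹ i) → S (x ⊹ i′) → j ≢ i → S (x ⊹ i ⊹ j) → j ≢ i′ × S (x ⊹ i′ ⊹ j)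
  transfer x i i′ j Sx Sxi Sxi′ j≢i Sxij with i ≟ i′
  ... | yes refl = j≢i , Sxij
  ... | no i≢i′ = let i′≢j , Sxi′j , _ = close (x ⊹ i′) i′ i j (≢-sym i≢i′) (≢-sym j≢i) Sxi′ (subst S (sym back) Sx)
                          (subst (λ u → S (u ⊹ i)) (sym back) Sxi) (subst (λ u → S (u ⊹ i ⊹ j)) (sym back) Sxij)
                  in ≢-sym i′≢j , Sxi′j
    where
    back : x ⊹ i′ ⊹ i′ ≡ x
    back = ⊹-inv x i′

  second : Subset D
  second = nb f (o ⊹ i₀) ⊹ i₀

  Λ : Subset D
  Λ = nb f o ∪ second

  i₀∈nb : nb f (o ⊹ i₀) ‼ i₀ ≡ true
  i₀∈nb = nb-in f (o ⊹ i₀) (subst S (sym (⊹-inv o i₀)) So)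

  second-out : ∀ {j} → second ‼ j ≡ true → j ≢ i₀ × S (o ⊹ i₀ ⊹ j)
  second-out {j} h with j ≟ i₀
  ... | yes refl = ⊥-elim (not-≢ {true} (trans (cong not (sym i₀∈nb)) (trans (sym (⊹-at (nb f (o ⊹ i₀)) i₀)) h)))
  ... | no j≢i₀ = j≢i₀ , nb-out f (o ⊹ i₀) (trans (sym (⊹-off (nb f (o ⊹ i₀)) j≢i₀)) h)

  Λ-out : ∀ {j} → Λ ‼ j ≡ true → S (o ⊹ j) ⊎ (j ≢ i₀ × S (o ⊹ i₀ ⊹ j))
  Λ-out {j} h with nb f o ‼ j in e | trans (sym (lookup-zipWith _∨_ j (nb f o) second)) h
  ... | true  | _ = inj₁ (nb-out f o e)
  ... | false | e′ = inj₂ (second-out e′)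

  Λ-first : ∀ {j} → S (o ⊹ j) → Λ ‼ j ≡ true
  Λ-first {j} h = trans (lookup-zipWith _∨_ j (nb f o) second) (cong (_∨ (second ‼ j)) (nb-in f o h))

  Λ-second : ∀ {j} → j ≢ i₀ → S (o ⊹ i₀ ⊹ j) → Λ ‼ j ≡ true
  Λ-second {j} j≢i₀ h = trans (lookup-zipWith _∨_ j (nb f o) second)
    (trans (cong ((nb f o ‼ j) ∨_) (trans (⊹-off (nb f (o ⊹ i₀)) j≢i₀) (nb-in f (o ⊹ i₀) h))) (∨-zeroʳ _))

  -- The degree at `o`, plus the degree at `o ⊹ i₀` less the edge back; a direction shared by both
  -- parts would close a square.
  Λ-size : ∣ Λ ∣ ≡ suc k + k
  Λ-size = trans (∣∪∣-disjoint (nb f o) second disjoint)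
    (cong₂ _+_ (regular o So) (suc-injective (trans (∣⊹∣-in (nb f (o ⊹ i₀)) i₀ i₀∈nb) (regular _ Soi₀))))
    where
    disjoint : ∀ i → nb f o ‼ i ≡ true → second ‼ i ≡ false
    disjoint i h = ¬-not λ h′ → let i≢i₀ , Soi₀i = second-out h′
                                in no4 o i₀ i (≢-sym i≢i₀) So Soi₀ (nb-out f o h) Soi₀i

  -- The directions at a neighbour x+i of x are i and those in Λ that are not directions at x.
  record Local (x : Vec Bool D) : Set where
    field
      near  : ∀ {j} → S (x ⊹ j) → Λ ‼ j ≡ true
      over  : ∀ {i j} → S (x ⊹ i) → j ≢ i → S (x ⊹ i ⊹ j) → Λ ‼ j ≡ true × ¬ S (x ⊹ j)
      under : ∀ {i j} → S (x ⊹ i) → Λ ‼ j ≡ true → ¬ S (x ⊹ j) → S (x ⊹ i ⊹ j)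
  open Local

  local-o : Local o
  local-o = record
    { near = Λ-first
    ; over = λ {i} {j} Soi j≢i Soij →
        (let j≢i₀ , h = transfer o i i₀ j So Soi Soi₀ j≢i Soij in Λ-second j≢i₀ h) ,
        (λ Soj → no4 o i j (≢-sym j≢i) So Soi Soj Soij)
    ; under = λ {i} {j} Soi Λj ¬Soj →
        [ (λ Soj → ⊥-elim (¬Soj Soj)) , (λ (j≢i₀ , h) → proj₂ (transfer o i₀ i j So Soi₀ Soi j≢i₀ h)) ]′ (Λ-out Λj) }

  local-step : ∀ x i → S x → S (x ⊹ i) → Local x → Local (x ⊹ i)
  local-step x i Sx Sxi loc = record { near = near′ ; over = over′ ; under = under′ }
    where
    back : x ⊹ i ⊹ i ≡ x
    back = ⊹-inv x i
    near′ : ∀ {j} → S (x ⊹ i ⊹ j) → Λ ‼ j ≡ true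
    near′ {j} h with j ≟ i
    ... | yes refl = near loc Sxi
    ... | no j≢i = proj₁ (over loc Sxi j≢i h)
    over′ : ∀ {i′ j} → S (x ⊹ i ⊹ i′) → j ≢ i′ → S (x ⊹ i ⊹ i′ ⊹ j) → Λ ‼ j ≡ true × ¬ S (x ⊹ i ⊹ j)
    over′ {i′} {j} Sxii′ j≢i′ h =
      let j≢i , Sxiij = transfer (x ⊹ i) i′ i j Sxi Sxii′ (subst S (sym back) Sx) j≢i′ h
          Sxj = subst (λ u → S (u ⊹ j)) back Sxiij
      in near loc Sxj , no4 x i j (≢-sym j≢i) Sx Sxi Sxj
    under′ : ∀ {i′ j} → S (x ⊹ i ⊹ i′) → Λ ‼ j ≡ true → ¬ S (x ⊹ i ⊹ j) → S (x ⊹ i ⊹ i′ ⊹ j)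
    under′ {i′} {j} Sxii′ Λj ¬Sxij with image? f (x ⊹ j)
    ... | no ¬Sxj = ⊥-elim (¬Sxij (under loc Sxi Λj ¬Sxj))
    ... | yes Sxj = proj₂ (transfer (x ⊹ i) i i′ j Sxi (subst S (sym back) Sx) Sxii′
                             (λ { refl → ¬Sxij (subst S (sym back) Sx) }) (subst (λ u → S (u ⊹ j)) (sym back) Sxj))

  φ : Vec Bool D → Subset D
  φ x = x ⊕ (nb f o ⊕ o)

  φ-o : φ o ≡ nb f o
  φ-o = trans (⊕-comm o (nb f o ⊕ o)) (⊕-cancel (nb f o) o)

  φ-⊹ : ∀ x i → φ (x ⊹ i) ≡ φ x ⊹ i
  φ-⊹ x i = ⊕-⊹ x (nb f o ⊕ o) i

  φ-injective : ∀ x y → φ x ≡ φ y → x ≡ y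
  φ-injective x y e = trans (sym (⊕-cancel x c)) (trans (cong (_⊕ c) e) (⊕-cancel y c))
    where c = nb f o ⊕ o

  φ-at : ∀ x i {β} → φ x ‼ i ≡ β → φ (x ⊹ i) ‼ i ≡ not β
  φ-at x i e = trans (cong (_‼ i) (φ-⊹ x i)) (trans (⊹-at (φ x) i) (cong not e))

  φ-off : ∀ x {i j} → j ≢ i → φ (x ⊹ i) ‼ j ≡ φ x ‼ j
  φ-off x {i} {j} j≢i = trans (cong (_‼ j) (φ-⊹ x i)) (⊹-off (φ x) j≢i)

  -- φ x is the neighbourhood of x if x is in the colour class of o, and its complement in Λ otherwise.
  data Layer (x : Vec Bool D) : Set where
    upper : (∀ {j} → S (x ⊹ j) → φ x ‼ j ≡ true) → (∀ {j} → φ x ‼ j ≡ true → S (x ⊹ j)) → Layer x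
    lower : (∀ {j} → S (x ⊹ j) → φ x ‼ j ≡ false) → (∀ {j} → Λ ‼ j ≡ true → φ x ‼ j ≡ false → S (x ⊹ j)) →
            φ x ⊑ Λ → Layer x

  -- By `Local`, the step `i` turns the neighbourhood into its complement in `Λ` with `i` added,
  -- whereas `φ` changes at `i` alone. So the two descriptions of `φ` alternate.
  layer-step : ∀ x i → S x → S (x ⊹ i) → Local x → Layer x → Layer (x ⊹ i)
  layer-step x i Sx Sxi loc (upper to from) = lower to′ from′ inside
    where
    φi : φ (x ⊹ i) ‼ i ≡ false
    φi = φ-at x i (to Sxi)
    to′ : ∀ {j} → S (x ⊹ i ⊹ j) → φ (x ⊹ i) ‼ j ≡ false
    to′ {j} h with j ≟ i
    ... | yes refl = φi
    ... | no j≢i = trans (φ-off x j≢i) (¬-not (λ e → proj₂ (over loc Sxi j≢i h) (from e)))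
    from′ : ∀ {j} → Λ ‼ j ≡ true → φ (x ⊹ i) ‼ j ≡ false → S (x ⊹ i ⊹ j)
    from′ {j} Λj e with j ≟ i
    ... | yes refl = subst S (sym (⊹-inv x i)) Sx
    ... | no j≢i = under loc Sxi Λj λ Sxj → not-≢ {true} (trans (sym e) (trans (φ-off x j≢i) (to Sxj)))
    inside : φ (x ⊹ i) ⊑ Λ
    inside j e with j ≟ i
    ... | yes refl = near loc Sxi
    ... | no j≢i = near loc (from (trans (sym (φ-off x j≢i)) e))
  layer-step x i Sx Sxi loc (lower to from inside) = upper to′ from′
    where
    φi : φ (x ⊹ i) ‼ i ≡ true
    φi = φ-at x i (to Sxi)
    to′ : ∀ {j} → S (x ⊹ i ⊹ j) → φ (x ⊹ i) ‼ j ≡ true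
    to′ {j} h with j ≟ i
    ... | yes refl = φi
    ... | no j≢i = let Λj , ¬Sxj = over loc Sxi j≢i h in trans (φ-off x j≢i) (¬-not (λ e → ¬Sxj (from Λj e)))
    from′ : ∀ {j} → φ (x ⊹ i) ‼ j ≡ true → S (x ⊹ i ⊹ j)
    from′ {j} e with j ≟ i
    ... | yes refl = subst S (sym (⊹-inv x i)) Sx
    ... | no j≢i = under loc Sxi (inside j e′) λ Sxj → not-≢ {true} (trans (sym (to Sxj)) e′)
      where e′ : φ x ‼ j ≡ true
            e′ = trans (sym (φ-off x j≢i)) e

  local-layer : ∀ x → S x → Local x × Layer x
  local-layer x Sx = go _ x refl Sx
    where
    go : ∀ h x → ham x o ≡ h → S x → Local x × Layer x
    go zero x e Sx rewrite ham-0 x o e =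
      local-o , upper (λ {j} s → trans (cong (_‼ j) φ-o) (nb-in f o s))
                (λ {j} e → nb-out f o (trans (sym (cong (_‼ j) φ-o)) e))
    go (suc h) x e Sx with iso x o Sx So (λ { refl → ℕ.1+n≢0 (trans (sym e) (ham-refl x)) })
    ... | i , ne , Sxi with go h (x ⊹ i) (suc-injective (trans (ham-toward x o i ne) e)) Sxi
    ... | loc , lay = subst (λ u → Local u × Layer u) (⊹-inv x i)
            (local-step (x ⊹ i) i Sxi Sxii loc , layer-step (x ⊹ i) i Sxi Sxii loc lay)
      where
      Sxii : S (x ⊹ i ⊹ i)
      Sxii = subst S (sym (⊹-inv x i)) Sx

  φ-⊑ : ∀ x → S x → φ x ⊑ Λ
  φ-⊑ x Sx with local-layer x Sx
  ... | loc , upper to from = λ j e → near loc (from e)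
  ... | loc , lower to from inside = inside

  upper-size : ∀ x → S x → (∀ {j} → S (x ⊹ j) → φ x ‼ j ≡ true) → (∀ {j} → φ x ‼ j ≡ true → S (x ⊹ j)) →
    ∣ φ x ∣ ≡ suc k
  upper-size x Sx to from = trans (ℕ.≤-antisym (⊆-∣∣ (φ x) (nb f x) λ j e → nb-in f x (from e))
    (⊆-∣∣ (nb f x) (φ x) λ j e → to (nb-out f x e))) (regular x Sx)

  -- A neighbour `x ⊹ i` is of the upper kind, and its image has `i` as one additional element.
  lower-size : ∀ x → S x → Local x → Layer x → (∀ {j} → S (x ⊹ j) → φ x ‼ j ≡ false) → ∣ φ x ∣ ≡ k
  lower-size x Sx loc lay to with neighbour x Sx
  ... | i , Sxi with layer-step x i Sx Sxi loc lay
  ... | upper to′ from′ = suc-injective (trans (sym (trans (cong ∣_∣ (φ-⊹ x i)) (∣⊹∣-out (φ x) i (to Sxi))))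
            (upper-size (x ⊹ i) Sxi to′ from′))
  -- Here `i` is a direction at `x ⊹ i` and also an element of its image, which the lower kind
  -- forbids.
  ... | lower to′ from′ inside′ = ⊥-elim (not-≢ {false}
            (trans (sym (φ-at x i (to Sxi))) (to′ (subst S (sym (⊹-inv x i)) Sx))))

  φ-middle : ∀ x → S x → Middle (suc k) (φ x)
  φ-middle x Sx with local-layer x Sx
  ... | loc , upper to from = inj₂ (upper-size x Sx to from)
  ... | loc , lay@(lower to from inside) = inj₁ (lower-size x Sx loc lay to)

  middle-≤ : ∀ {m} (T : Subset m) → Middle (suc k) T → ∣ T ∣ ≤ suc k
  middle-≤ T (inj₁ e) = ≤-trans (≤-reflexive e) (ℕ.n≤1+n k)
  middle-≤ T (inj₂ e) = ≤-reflexive e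

  middle-≥ : ∀ {m} (T : Subset m) → Middle (suc k) T → k ≤ ∣ T ∣
  middle-≥ T (inj₁ e) = ≤-reflexive (sym e)
  middle-≥ T (inj₂ e) = ≤-trans (ℕ.n≤1+n k) (≤-reflexive (sym e))

  -- Comparing sizes yields a step towards `T`: from the upper layer some element outside `T` can be
  -- removed, from the lower one an element of `T` can be added, and either is a direction at `x`.
  φ-onto : ∀ T → T ⊑ Λ → Middle (suc k) T → ∃[ u ] φ (f u) ≡ T
  φ-onto T T⊑Λ mid = go _ o refl So
    where
    toward : ∀ {h} x i → ham (φ x) T ≡ suc h → φ x ‼ i ≢ T ‼ i → ham (φ (x ⊹ i)) T ≡ h
    toward x i e ne = suc-injective (trans (cong (λ p → suc (ham p T)) (φ-⊹ x i)) (trans (ham-toward (φ x) T i ne) e))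
    differ : ∀ {h} x → ham (φ x) T ≡ suc h → φ x ≢ T
    differ x e refl = ℕ.1+n≢0 (trans (sym e) (ham-refl (φ x)))
    go : ∀ h x → ham (φ x) T ≡ h → S x → ∃[ u ] φ (f u) ≡ T
    go zero x e (u , fu) = u , trans (cong φ fu) (ham-0 (φ x) T e)
    go (suc h) x e Sx with local-layer x Sx
    ... | loc , upper to from =
      let i , φi , Ti = escape (φ x) T (differ x e) (≤-trans (middle-≤ T mid)
                (≤-reflexive (sym (upper-size x Sx to from))))
      in go h (x ⊹ i) (toward x i e (λ h → not-≢ {true} (trans (sym Ti) (trans (sym h) φi)))) (from φi)
    ... | loc , lay@(lower to from inside) =
      let i , Ti , φi = escape T (φ x) (≢-sym (differ x e))
                (≤-trans (≤-reflexive (lower-size x Sx loc lay to)) (middle-≥ T mid))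
      in go h (x ⊹ i) (toward x i e (λ h → not-≢ {true} (trans (sym φi) (trans h Ti)))) (from (T⊑Λ i Ti) φi)

-- `IsoDoubledOdd` with the size of the ground set left free, so that the size of `Λ` can be
-- exchanged for 2k-1 by `subst`.
MiddleLayers : Graph → ℕ → ℕ → Set
MiddleLayers G k m = Σ (Fin (Graph.n G) → Subset m) λ φ →
  Injective _≡_ _≡_ φ × (∀ x → Middle k (φ x)) × (∀ s → Middle k s → ∃[ x ] φ x ≡ s) ×
  (∀ x y → (Adj G x y → Nested k (φ x) (φ y)) × (Nested k (φ x) (φ y) → Adj G x y))

module _ (G : Graph) {D} (f : Fin (Graph.n G) → Vec Bool D) (induced : Induced G f) (iso : IsometricIn (Image f))
          (no4 : NoSquares (Image f))
  (close : PathsClose (Image f)) (k : ℕ) (regular : ∀ x → Image f x → ∣ nb f x ∣ ≡ suc k) (u₀ : Fin (Graph.n G)) where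
  open Graph G
  open Induced induced
  open Layers k
  open Layered f iso no4 close k regular (f u₀) (u₀ , refl)

  ψ : Fin n → Subset ∣ Λ ∣
  ψ u = restrict Λ (φ (f u))

  extend-ψ : ∀ u → extend Λ (ψ u) ≡ φ (f u)
  extend-ψ u = extend-restrict Λ (φ (f u)) (φ-⊑ (f u) (u , refl))

  middle-layers : MiddleLayers G (suc k) ∣ Λ ∣
  middle-layers = ψ , ψ-injective , ψ-middle , ψ-onto , λ u v → adj⇒nested u v , nested⇒adj u v
    where
    ψ-injective : Injective _≡_ _≡_ ψ
    ψ-injective {u} {v} e = inj (φ-injective (f u) (f v)
              (trans (sym (extend-ψ u)) (trans (cong (extend Λ) e) (extend-ψ v))))
    ψ-middle : ∀ u → Middle (suc k) (ψ u)
    ψ-middle u = subst (λ s → s ≡ k ⊎ s ≡ suc k) (trans (cong ∣_∣ (sym (extend-ψ u))) (∣extend∣ Λ (ψ u)))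
              (φ-middle (f u) (u , refl))
    ψ-onto : ∀ s → Middle (suc k) s → ∃[ u ] ψ u ≡ s
    ψ-onto s mid =
      let u , e = φ-onto (extend Λ s) (extend-⊑ Λ s) (subst (λ t → t ≡ k ⊎ t ≡ suc k) (sym (∣extend∣ Λ s)) mid)
      in u , trans (cong (restrict Λ) e) (restrict-extend Λ s)
    adj⇒nested : ∀ u v → Adj G u v → Nested (suc k) (ψ u) (ψ v)
    adj⇒nested u v uv =
      let i , e = adj⇒ uv
          t , e′ = restrict-⊹ Λ (φ (f u)) i (Local.near (proj₁ (local-layer (f u) (u , refl))) (v , e))
          e″ : ψ v ≡ ψ u ⊹ t
          e″ = trans (cong (restrict Λ) (trans (cong φ e) (φ-⊹ (f u) i))) e′
      in subst (Nested (suc k) (ψ u)) (sym e″) (flip⇒nested (ψ u) t (ψ-middle u)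
                (subst (Middle (suc k)) e″ (ψ-middle v)))
    nested⇒adj : ∀ u v → Nested (suc k) (ψ u) (ψ v) → Adj G u v
    nested⇒adj u v nest =
      let t , e = nested⇒flip nest
          i , e′ = extend-⊹ Λ (ψ u) t
      in ⇒adj {i = i} (φ-injective (f v) (f u ⊹ i) (trans (sym (extend-ψ v)) (trans (cong (extend Λ) e)
           (trans e′ (trans (cong (_⊹ i) (extend-ψ u)) (sym (φ-⊹ (f u) i)))))))

  doubled-odd : IsoDoubledOdd G (suc k)
  doubled-odd = subst (MiddleLayers G (suc k)) (trans Λ-size odd) middle-layers
    where
    odd : suc k + k ≡ 2 * suc k ∸ 1
    odd = sym (trans (cong (k +_) (ℕ.+-identityʳ (suc k))) (+-suc k k))

theorem4p2 : (G : Graph) (k : ℕ) → Regular G k → PartialCube G → Girth G 6 →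
    (AllConvexCycles6 G ⇔ P3InC6 G) × (P3InC6 G ⇔ IsoDoubledOdd G k)
theorem4p2 G k regular (d , f , dist) (hexagon , girth)
  with PartialCubes.cycle-degree G f dist regular hexagon
... | r , refl = mk⇔ convex⇒paths (closed⇒convex-6 girth ∘ paths⇒closed) ,
                 mk⇔ paths⇒doubled-odd (doubled-odd⇒P3InC6 G (suc r))
  where
  open PartialCubes G f dist
  open Convexity G f dist using (zones)
  open ClosedConvex G f dist using (closed⇒convex-6)
  no4-cycle : ¬ Cycle G 4
  no4-cycle = girth 4 (ℕ.n≤1+n 5)
  no4 : NoSquares (Image f)
  no4 = no-squares no4-cycle
  nb-size : ∀ x → Image f x → ∣ nb f x ∣ ≡ suc (suc r)
  nb-size _ (u , refl) = trans (neighbours≡degree u) (regular u)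
  convex⇒paths : AllConvexCycles6 G → P3InC6 G
  convex⇒paths convex6 = Embedded.paths-close⇒P3InC6 G f induced
    (RegularHexagonal.paths-close f isometric no4 (zones no4-cycle convex6) r nb-size)
  paths⇒closed : P3InC6 G → PathsClose (Image f)
  paths⇒closed = Closing.P3InC6⇒paths-close G f induced no4 isometric
  paths⇒doubled-odd : P3InC6 G → IsoDoubledOdd G (suc (suc r))
  -- Any vertex can be the base `o`; the hexagon supplies one.
  paths⇒doubled-odd p3 = doubled-odd G f induced isometric no4 (paths⇒closed p3) (suc r) nb-size (Cycle.c hexagon 0F)
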